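{- Let $\sigma$ and $\tau$ be (possibly empty) non-crossing partitions, and let $\rho,\rho'$ be cc-equivalent non-crossing partitions. Then $\sigma[\rho][\tau]$ and $\sigma[\rho'][\tau]$ are cc-equivalent.
   Context: Set partitions are written in canonical sequential form (restricted growth words). A partition is non-crossing if it avoids the pattern $1212$ (pattern containment = having a subsequence order-isomorphic to the pattern). For partitions $\alpha,\beta$, $\alpha[\beta]$ is the concatenation of $\alpha$ with $\beta+r$, $r$ the number of blocks of $\alpha$ ($\beta+r$ adds $r$ to every letter); this is associative. A partition $\pi$ is connected if it cannot be written as $\alpha[\beta]$ with $\alpha,\beta$ nonempty; every partition is uniquely $\pi=\sigma_1[\sigma_2]\cdots[\sigma_m]$ with nonempty connected $\sigma_i$, its components. Two non-crossing patterns $\sigma,\tau$ are cc-equivalent if there is a bijection from the set of partitions avoiding both $1212$ and $\sigma$ to the set of partitions avoiding both $1212$ and $\tau$ that preserves size and number of components. -}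

module Defs where

open import Data.Fin.Base using (Fin; cast)
open import Data.List.Base using (List; []; _∷_; _++_; map; foldr; length; lookup)
open import Data.List.Relation.Binary.Sublist.Propositional using (_⊆_)
open import Data.List.Relation.Unary.All using (All)
open import Data.Nat.Base using (ℕ; suc; _+_; _⊔_; _≤_; _<_; s≤s; z≤n)
open import Data.Nat.Properties
  using (⊔-identityʳ; ⊔-assoc; +-distribʳ-⊔; +-monoˡ-≤; ≤-trans; m≤m+n)
open import Data.Product.Base using (Σ; ∃; _×_; _,_)
open import Function.Bundles using (_⇔_; Bijection)
open import Level using (0ℓ)
open import Relation.Binary.Bundles using (Setoid)
import Relation.Binary.Construct.On as On
open import Relation.Binary.PropositionalEquality
  using (_≡_; _≢_; subst; sym; setoid)
open import Relation.Nullary.Negation using (¬_)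

infixl 20 _[_]

-- RestrictedGrowth m w: the word w may follow a prefix whose largest letter
-- is m.  Every letter is at least 1 and exceeds the maximum of everything
-- before it by at most 1.
data RestrictedGrowth (m : ℕ) : List ℕ → Set where
  []   : RestrictedGrowth m []
  cons : ∀ {x w} → 1 ≤ x → x ≤ suc m → RestrictedGrowth (m ⊔ x) w →
         RestrictedGrowth m (x ∷ w)

-- Set partitions in canonical sequential form; the empty partition is included.
record Partition : Set where
  constructor mkPartition
  field
    word      : List ℕ
    canonical : RestrictedGrowth 0 word

open Partition public

size : Partition → ℕ
size π = length (word π)

maxLetter : List ℕ → ℕ
maxLetter = foldr _⊔_ 0

-- The letters of a canonical sequential form with k blocks are exactly
-- 1, …, k, so k is the largest letter.
blocks : Partition → ℕ
blocks π = maxLetter (word π)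

growth-++ : ∀ {m u v} → RestrictedGrowth m u →
            RestrictedGrowth (m ⊔ maxLetter u) v → RestrictedGrowth m (u ++ v)
growth-++ {m} {v = v} [] gv =
  subst (λ k → RestrictedGrowth k v) (⊔-identityʳ m) gv
growth-++ {m} {x ∷ u} {v} (cons 1≤x x≤ gu) gv =
  cons 1≤x x≤ (growth-++ gu
    (subst (λ k → RestrictedGrowth k v) (sym (⊔-assoc m x (maxLetter u))) gv))

growth-shift : ∀ {m w} r → RestrictedGrowth m w →
               RestrictedGrowth (m + r) (map (_+ r) w)
growth-shift r [] = []
growth-shift {m} {x ∷ w} r (cons 1≤x x≤ g) =
  cons (≤-trans 1≤x (m≤m+n x r)) (+-monoˡ-≤ r x≤)
    (subst (λ k → RestrictedGrowth k (map (_+ r) w)) (+-distribʳ-⊔ r m x)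
      (growth-shift r g))

_[_] : Partition → Partition → Partition
α [ β ] = record
  { word      = word α ++ map (_+ blocks α) (word β)
  ; canonical = growth-++ (canonical α) (growth-shift (blocks α) (canonical β))
  }

-- Equal letters need no separate clause: by trichotomy they are those for
-- which < holds in neither direction.
OrderIsomorphic : List ℕ → List ℕ → Set
OrderIsomorphic u v = Σ (length u ≡ length v) λ eq → (i j : Fin (length u)) →
  lookup u i < lookup u j ⇔ lookup v (cast eq i) < lookup v (cast eq j)

_Contains_ : Partition → Partition → Set
π Contains σ = ∃ λ s → s ⊆ word π × OrderIsomorphic s (word σ)

_Avoids_ : Partition → Partition → Set
π Avoids σ = ¬ (π Contains σ)

crossing : Partition
crossing = mkPartition (1 ∷ 2 ∷ 1 ∷ 2 ∷ [])
  (cons (s≤s z≤n) (s≤s z≤n)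
  (cons (s≤s z≤n) (s≤s (s≤s z≤n))
  (cons (s≤s z≤n) (s≤s z≤n)
  (cons (s≤s z≤n) (s≤s (s≤s z≤n)) []))))

NonCrossing : Partition → Set
NonCrossing π = π Avoids crossing

∅ : Partition
∅ = mkPartition [] []

Nonempty : Partition → Set
Nonempty π = word π ≢ []

Connected : Partition → Set
Connected π = ¬ (∃ λ α → ∃ λ β →
  Nonempty α × Nonempty β × word π ≡ word (α [ β ]))

-- The right-nested product α₁[α₂[⋯[αₘ[∅]]]] is α₁[α₂]⋯[αₘ], as _[_] is
-- associative on words with unit ∅.
compose : List Partition → Partition
compose = foldr _[_] ∅

AreComponentsOf : List Partition → Partition → Set
AreComponentsOf σs π =
  All (λ σ → Nonempty σ × Connected σ) σs × word π ≡ word (compose σs)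

-- A relation rather than a function; the factorization into components exists
-- and is unique, so exactly one m satisfies it for each π.
HasComponents : Partition → ℕ → Set
HasComponents π m = ∃ λ σs → AreComponentsOf σs π × length σs ≡ m

record Avoider (σ : Partition) : Set where
  field
    underlying  : Partition
    nonCrossing : NonCrossing underlying
    avoids      : underlying Avoids σ

open Avoider public using (underlying)

-- The set of partitions avoiding 1212 and σ: elements are compared by their
-- words, ignoring the proofs they carry.
AvoiderSetoid : Partition → Setoid 0ℓ 0ℓ
AvoiderSetoid σ =
  On.setoid (setoid (List ℕ)) (λ (a : Avoider σ) → word (underlying a))

record CCEquivalent (σ τ : Partition) : Set where
  field
    nonCrossingˡ : NonCrossing σ
    nonCrossingʳ : NonCrossing τ
    bijection    : Bijection (AvoiderSetoid σ) (AvoiderSetoid τ)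

  open Bijection bijection using (to)

  field
    preservesSize : ∀ π → size (underlying (to π)) ≡ size (underlying π)
    preservesComponents : ∀ π m →
      HasComponents (underlying (to π)) m ⇔ HasComponents (underlying π) m

-- Reading a non-crossing word from left to right, keep the stack of letters that may still
-- reappear. Each letter is either new (push) or returns to a letter of the stack (pop down
-- to it), so the word is coded by a list of such operations, and the number of components
-- of a prefix is the depth of the stack after it. Which codes may follow a prefix depends only
-- on that depth.
--
-- A word contains α[β] exactly when some cut leaves α in the prefix and β among those
-- letters of the suffix that do not occur in the prefix; in the code these are obtained by
-- deleting the returns that leave the part of the stack built by the suffix.
--
-- For σ[ρ], cut after the shortest prefix containing σ. The new letters of the suffix form a
-- partition avoiding ρ; the deleted returns sit at boundaries of its components, so it can be
-- exchanged for its image, which avoids ρ′ and has equally many components.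
-- For ρ[τ], cut before the shortest suffix whose new letters contain τ. The prefix avoids ρ
-- and can be exchanged for its image, since that has the same depth.

module Submission where

open import Defs
open import Data.Fin.Base using (cast) renaming (zero to fzero; suc to fsuc)
open import Data.List.Base using (List; []; _∷_; _++_; map; length; lookup; filter)
open import Data.List.Membership.Propositional using (_∈_; _∉_)
open import Data.List.Properties
  using (length-++; length-map; map-++; map-∘; map-cong; ++-identityʳ; ++-assoc; ∷-injective;
         filter-++; filter-all; filter-reject)
open import Data.List.Relation.Binary.Pointwise using (Pointwise; []; _∷_)
import Data.List.Relation.Binary.Pointwise as Pointwise
open import Data.List.Relation.Binary.Sublist.Propositional
  using (_⊆_; []; _∷_; _∷ʳ_; ⊆-refl; ⊆-trans; ⊆-reflexive; to∈; from∈)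
import Data.List.Relation.Binary.Sublist.Propositional.Properties as Sublist
open import Data.List.Relation.Unary.All using (All; []; _∷_)
import Data.List.Relation.Unary.All as All
import Data.List.Relation.Unary.All.Properties as All
open import Data.List.Relation.Unary.Any using (here; there)
open import Data.Nat.Base using (ℕ; zero; suc; _+_; _∸_; _⊔_; _≤_; _<_; s≤s; z≤n)
open import Data.Nat.Properties
open import Data.Product.Base using (∃; ∃₂; _×_; _,_; proj₁; proj₂)
open import Data.Sum.Base using (_⊎_; inj₁; inj₂)
open import Function.Base using (_∘_; flip)
open import Function.Bundles using (_⇔_; mk⇔; Bijection; Equivalence)
open import Function.Properties.Equivalence using () renaming (sym to ⇔-sym; trans to ⇔-trans)
open import Relation.Binary.PropositionalEquality hiding ([_])
open import Relation.Nullary.Decidable using (Dec; yes; no; map′; _×-dec_; _→-dec_)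
open import Relation.Nullary.Negation using (¬_; contradiction)
open import Relation.Unary using (Decidable)

-- Order isomorphism and occurrences of words

SameOrder : ℕ → ℕ → ℕ → ℕ → Set
SameOrder x y c d = (x < c ⇔ y < d) × (c < x ⇔ d < y)

infix 4 _≅_

-- Order isomorphism in a form fit for induction on words: each letter is compared, in both
-- directions, with the letters after it.
data _≅_ : List ℕ → List ℕ → Set where
  []  : [] ≅ []
  _∷_ : ∀ {x y u v} → Pointwise (SameOrder x y) u v → u ≅ v → x ∷ u ≅ y ∷ v

≅⇒length : ∀ {u v} → u ≅ v → length u ≡ length v
≅⇒length []      = refl
≅⇒length (_ ∷ p) = cong suc (≅⇒length p)

≅⇒OrderIsomorphic : ∀ {u v} → u ≅ v → OrderIsomorphic u v
≅⇒OrderIsomorphic p = ≅⇒length p , λ i j → compare p i j (≅⇒length p)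
  where
  lookups : ∀ {x y u v} → Pointwise (SameOrder x y) u v → ∀ i (eq : length u ≡ length v) →
            SameOrder x y (lookup u i) (lookup v (cast eq i))
  lookups (r ∷ _)  fzero    eq = r
  lookups (_ ∷ rs) (fsuc i) eq = lookups rs i (suc-injective eq)

  compare : ∀ {u v} → u ≅ v → ∀ i j (eq : length u ≡ length v) →
            lookup u i < lookup u j ⇔ lookup v (cast eq i) < lookup v (cast eq j)
  compare (rs ∷ p) fzero    fzero    eq =
    mk⇔ (λ lt → contradiction lt (n≮n _)) (λ lt → contradiction lt (n≮n _))
  compare (rs ∷ p) fzero    (fsuc j) eq = proj₁ (lookups rs j (suc-injective eq))
  compare (rs ∷ p) (fsuc i) fzero    eq = proj₂ (lookups rs i (suc-injective eq))
  compare (rs ∷ p) (fsuc i) (fsuc j) eq = compare p i j (suc-injective eq)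

OrderIsomorphic⇒≅ : ∀ u v → OrderIsomorphic u v → u ≅ v
OrderIsomorphic⇒≅ []      []      _          = []
OrderIsomorphic⇒≅ []      (_ ∷ _) (() , _)
OrderIsomorphic⇒≅ (_ ∷ _) []      (() , _)
OrderIsomorphic⇒≅ (x ∷ u) (y ∷ v) (eq , iso) =
  heads u v (suc-injective eq) (λ i → iso fzero (fsuc i) , iso (fsuc i) fzero) ∷
  OrderIsomorphic⇒≅ u v (suc-injective eq , λ i j → iso (fsuc i) (fsuc j))
  where
  heads : ∀ u v (eq : length u ≡ length v) →
          (∀ i → SameOrder x y (lookup u i) (lookup v (cast eq i))) →
          Pointwise (SameOrder x y) u v
  heads []      []      eq f = []
  heads (_ ∷ u) (_ ∷ v) eq f = f fzero ∷ heads u v (suc-injective eq) (f ∘ fsuc)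

≅-sym : ∀ {u v} → u ≅ v → v ≅ u
≅-sym []       = []
≅-sym (rs ∷ p) =
  Pointwise.symmetric (λ (a , b) → ⇔-sym a , ⇔-sym b) rs ∷ ≅-sym p

≅-trans : ∀ {u v w} → u ≅ v → v ≅ w → u ≅ w
≅-trans []       []       = []
≅-trans (rs ∷ p) (ss ∷ q) =
  Pointwise.transitive
    (λ (a , b) (c , d) → ⇔-trans a c , ⇔-trans b d) rs ss ∷
  ≅-trans p q

≅-shift : ∀ r u → u ≅ map (_+ r) u
≅-shift r []      = []
≅-shift r (x ∷ u) = heads u ∷ ≅-shift r u
  where
  heads : ∀ u → Pointwise (SameOrder x (x + r)) u (map (_+ r) u)
  heads []      = []
  heads (y ∷ u) =
    (mk⇔ (+-monoˡ-< r) (+-cancelʳ-< r x y) , mk⇔ (+-monoˡ-< r) (+-cancelʳ-< r y x)) ∷ heads u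

_≅?_ : ∀ u v → Dec (u ≅ v)
[]      ≅? []      = yes []
[]      ≅? (_ ∷ _) = no λ()
(_ ∷ _) ≅? []      = no λ()
(x ∷ u) ≅? (y ∷ v) = map′ (λ (rs , p) → rs ∷ p) (λ { (rs ∷ p) → rs , p })
  (Pointwise.decidable (λ c d → ((x <? c) ⇔? (y <? d)) ×-dec ((c <? x) ⇔? (d <? y))) u v ×-dec (u ≅? v))
  where
  _⇔?_ : ∀ {A B : Set} → Dec A → Dec B → Dec (A ⇔ B)
  a? ⇔? b? = map′ (λ (f , g) → mk⇔ f g) (λ e → Equivalence.to e , Equivalence.from e)
    ((a? →-dec b?) ×-dec (b? →-dec a?))

-- The thresholds `k` and `l` settle every comparison across the two halves in the same way: the
-- left letter is the smaller one.
≅-++ : ∀ {u v u′ v′ k l} → u ≅ u′ → v ≅ v′ →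
       All (_≤ k) u → All (k <_) v → All (_≤ l) u′ → All (l <_) v′ → u ++ v ≅ u′ ++ v′
≅-++ []       q _            _  _            _  = q
≅-++ {k = k} {l} (_∷_ {x} {y} rs p) q (x≤k ∷ us) vs (y≤l ∷ us′) vs′ =
  Pointwise.++⁺ rs (below q vs vs′) ∷ ≅-++ p q us vs us′ vs′
  where
  below : ∀ {v v′} → v ≅ v′ → All (k <_) v → All (l <_) v′ → Pointwise (SameOrder x y) v v′
  below []      []         []          = []
  below (_ ∷ q) (k<c ∷ vs) (l<d ∷ vs′) =
    (mk⇔ (λ _ → y<d) (λ _ → x<c) ,
     mk⇔ (λ c<x → contradiction c<x (<-asym x<c)) (λ d<y → contradiction d<y (<-asym y<d))) ∷
    below q vs vs′
    where
    x<c = ≤-<-trans x≤k k<c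
    y<d = ≤-<-trans y≤l l<d

-- Converse direction: cutting `s` at the length of `u` works, since the inequalities across the cut
-- are pulled back along the isomorphism.
≅-++⁻ : ∀ s {u v k} → s ≅ u ++ v → All (_≤ k) u → All (k <_) v →
        ∃₂ λ a b → s ≡ a ++ b × a ≅ u × b ≅ v × All (λ x → All (x <_) b) a
≅-++⁻ s       {[]}     p        us         vs = [] , s , refl , [] , p , []
≅-++⁻ (x ∷ s) {y ∷ u} {v} {k} (rs ∷ p) (y≤k ∷ us) vs with ≅-++⁻ s p us vs
... | a , b , refl , pa , pb , a<b =
  x ∷ a , b , refl , ++⁻ˡ a u (≅⇒length pa) rs ∷ pa , pb , above a u (≅⇒length pa) rs vs ∷ a<b
  where
  ++⁻ˡ : ∀ a u {b v} → length a ≡ length u → Pointwise (SameOrder x y) (a ++ b) (u ++ v) →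
         Pointwise (SameOrder x y) a u
  ++⁻ˡ []      []      eq rs       = []
  ++⁻ˡ (_ ∷ a) (_ ∷ u) eq (r ∷ rs) = r ∷ ++⁻ˡ a u (suc-injective eq) rs

  above : ∀ a u {b v} → length a ≡ length u → Pointwise (SameOrder x y) (a ++ b) (u ++ v) →
          All (k <_) v → All (x <_) b
  above []      []      eq []       []         = []
  above []      []      eq (r ∷ rs) (k<d ∷ vs) =
    Equivalence.from (proj₁ r) (≤-<-trans y≤k k<d) ∷ above [] [] refl rs vs
  above (_ ∷ a) (_ ∷ u) eq (r ∷ rs) vs         = above a u (suc-injective eq) rs vs

record Occurs (t w : List ℕ) : Set where
  constructor occurs
  field
    {copy}    : List ℕ
    embedding : copy ⊆ w
    isCopy    : copy ≅ t

Contains⇒Occurs : ∀ {π σ} → π Contains σ → Occurs (word σ) (word π)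
Contains⇒Occurs (s , s⊆w , iso) = occurs s⊆w (OrderIsomorphic⇒≅ s _ iso)

Occurs⇒Contains : ∀ {π σ} → Occurs (word σ) (word π) → π Contains σ
Occurs⇒Contains (occurs s⊆w p) = _ , s⊆w , ≅⇒OrderIsomorphic p

Occurs-⊆ : ∀ {t v w} → v ⊆ w → Occurs t v → Occurs t w
Occurs-⊆ v⊆w (occurs s⊆v p) = occurs (⊆-trans s⊆v v⊆w) p

⊆-map⁻ : ∀ (f : ℕ → ℕ) {s} w → s ⊆ map f w → ∃ λ s′ → s ≡ map f s′ × s′ ⊆ w
⊆-map⁻ f []      []           = [] , refl , []
⊆-map⁻ f (x ∷ w) (_ ∷ʳ p)     with ⊆-map⁻ f w p
... | s , eq , q = s , eq , x ∷ʳ q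
⊆-map⁻ f (x ∷ w) (refl ∷ p)   with ⊆-map⁻ f w p
... | s , eq , q = x ∷ s , cong (f x ∷_) eq , refl ∷ q

Occurs-shift⁺ : ∀ {t} r w → Occurs t w → Occurs t (map (_+ r) w)
Occurs-shift⁺ r w (occurs {s} s⊆w p) = occurs (Sublist.map⁺ (_+ r) s⊆w) (≅-trans (≅-sym (≅-shift r s)) p)

Occurs-shift⁻ : ∀ {t} r w → Occurs t (map (_+ r) w) → Occurs t w
Occurs-shift⁻ r w (occurs s⊆ p) with ⊆-map⁻ (_+ r) w s⊆
... | s′ , refl , s′⊆w = occurs s′⊆w (≅-trans (≅-shift r s′) p)

anySublist? : ∀ {P : List ℕ → Set} → Decidable P → ∀ w → Dec (∃ λ s → s ⊆ w × P s)
anySublist? P? []      = map′ (λ p → [] , [] , p) (λ { (_ , [] , p) → p }) (P? [])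
anySublist? P? (x ∷ w) with anySublist? P? w
... | yes (s , s⊆w , p) = yes (s , x ∷ʳ s⊆w , p)
... | no ¬skip with anySublist? (P? ∘ (x ∷_)) w
...   | yes (s , s⊆w , p) = yes (x ∷ s , refl ∷ s⊆w , p)
...   | no ¬take = no λ { (s , (_ ∷ʳ s⊆w) , p)         → ¬skip (s , s⊆w , p)
                        ; (_ ∷ s , (refl ∷ s⊆w) , p)   → ¬take (s , s⊆w , p) }

occurs? : ∀ t → Decidable (Occurs t)
occurs? t w = map′ (λ (_ , s⊆w , p) → occurs s⊆w p) (λ (occurs s⊆w p) → _ , s⊆w , p)
  (anySublist? (_≅? t) w)

crossing-occurs : ∀ {a b w} → a < b → a ∷ b ∷ a ∷ b ∷ [] ⊆ w → Occurs (word crossing) w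
crossing-occurs {a} {b} a<b s⊆w = occurs s⊆w
  ((lt ∷ eq ∷ lt ∷ []) ∷ (gt ∷ eq′ ∷ []) ∷ (lt ∷ []) ∷ [] ∷ [])
  where
  1<2 : 1 < 2
  1<2 = n<1+n 1
  lt  = mk⇔ (λ _ → 1<2) (λ _ → a<b) , mk⇔ (λ b<a → contradiction b<a (<-asym a<b)) λ { (s≤s ()) }
  gt  = mk⇔ (λ b<a → contradiction b<a (<-asym a<b)) (λ { (s≤s ()) }) , mk⇔ (λ _ → 1<2) (λ _ → a<b)
  none : ∀ {m n : ℕ} → m < m ⇔ n < n
  none = mk⇔ (λ lt → contradiction lt (n≮n _)) (λ lt → contradiction lt (n≮n _))
  eq  = none , none
  eq′ = none , none

crossing-occurs⁻ : ∀ {w} → Occurs (word crossing) w → ∃₂ λ a b → a < b × a ∷ b ∷ a ∷ b ∷ [] ⊆ w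
crossing-occurs⁻ (occurs {a ∷ b ∷ c ∷ d ∷ []} s⊆w ((ab ∷ ac ∷ _) ∷ (_ ∷ bd ∷ []) ∷ _))
  with equal ac | equal bd
  where
  -- Equal pattern letters satisfy neither strict inequality, so neither do their copies.
  equal : ∀ {x c n} → SameOrder x n c n → x ≡ c
  equal {x} {c} (l , g) = ≤-antisym (≮⇒≥ λ c<x → n≮n _ (Equivalence.to g c<x))
                                    (≮⇒≥ λ x<c → n≮n _ (Equivalence.to l x<c))
... | refl | refl = a , b , Equivalence.from (proj₁ ab) (n<1+n 1) , s⊆w

-- Codes of non-crossing words

data Op : Set where
  new : Op
  ret : ℕ → Op

Code : Set
Code = List Op

data Pop : ℕ → List ℕ → ℕ → List ℕ → Set where
  here  : ∀ {x t} → Pop 0 (x ∷ t) x t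
  there : ∀ {j y t x t′} → Pop j t x t′ → Pop (suc j) (y ∷ t) x t′

-- Reads m t os w m′ t′: after a prefix with letters 1, …, m of which those in t may reappear
-- (largest first), os spells w and leaves the state m′, t′.
data Reads (m : ℕ) (t : List ℕ) : Code → List ℕ → ℕ → List ℕ → Set where
  []  : Reads m t [] [] m t
  new : ∀ {os w m′ t′} → Reads (suc m) (suc m ∷ t) os w m′ t′ →
        Reads m t (new ∷ os) (suc m ∷ w) m′ t′
  ret : ∀ {j x t₁ os w m′ t′} → Pop j t x t₁ → Reads m (x ∷ t₁) os w m′ t′ →
        Reads m t (ret j ∷ os) (x ∷ w) m′ t′

-- The shadow of `Reads` on stack depths. `ret j` discards `j` entries and keeps the one returned
-- to, so at least one entry remains.
data Run : ℕ → Code → ℕ → Set where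
  []  : ∀ {d} → Run d [] d
  new : ∀ {d os e} → Run (suc d) os e → Run d (new ∷ os) e
  ret : ∀ {d j c os e} → j + suc c ≡ d → Run (suc c) os e → Run d (ret j ∷ os) e

Pop-det : ∀ {j t x t₁ y t₂} → Pop j t x t₁ → Pop j t y t₂ → x ≡ y × t₁ ≡ t₂
Pop-det here      here      = refl , refl
Pop-det (there p) (there q) = Pop-det p q

Reads-det : ∀ {m t os w m₁ t₁ v m₂ t₂} → Reads m t os w m₁ t₁ → Reads m t os v m₂ t₂ →
            w ≡ v × m₁ ≡ m₂ × t₁ ≡ t₂
Reads-det []        []        = refl , refl , refl
Reads-det (new r)   (new s)   with Reads-det r s
... | refl , refl , refl = refl , refl , refl
Reads-det (ret p r) (ret q s) with Pop-det p q
... | refl , refl with Reads-det r s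
... | refl , refl , refl = refl , refl , refl

Pop-length : ∀ {j t x t₁} → Pop j t x t₁ → j + suc (length t₁) ≡ length t
Pop-length here      = refl
Pop-length (there p) = cong suc (Pop-length p)

pop : ∀ j t {c} → j + suc c ≡ length t → ∃₂ λ x t₁ → Pop j t x t₁ × length t₁ ≡ c
pop zero    (x ∷ t) eq = x , t , here , sym (suc-injective eq)
pop zero    []      ()
pop (suc j) []      ()
pop (suc j) (y ∷ t) eq with pop j t (suc-injective eq)
... | x , t₁ , p , q = x , t₁ , there p , q

-- Depth is the only obstruction: `new` supplies its own letter, and a return needs only enough
-- entries on the stack. This lets a code be moved behind another prefix of the same depth.
Run⇒Reads : ∀ {os e} m t → Run (length t) os e →
            ∃₂ λ w m′ → ∃ λ t′ → Reads m t os w m′ t′ × length t′ ≡ e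
Run⇒Reads m t []       = [] , m , t , [] , refl
Run⇒Reads m t (new r)  with Run⇒Reads (suc m) (suc m ∷ t) r
... | w , m′ , t′ , s , eq = _ , m′ , t′ , new s , eq
Run⇒Reads m t (ret {j = j} eq r) with pop j t eq
... | x , t₁ , p , refl with Run⇒Reads m (x ∷ t₁) r
... | w , m′ , t′ , s , eq′ = _ , m′ , t′ , ret p s , eq′

Reads⇒Run : ∀ {m t os w m′ t′} → Reads m t os w m′ t′ → Run (length t) os (length t′)
Reads⇒Run []        = []
Reads⇒Run (new r)   = new (Reads⇒Run r)
Reads⇒Run (ret p r) = ret (Pop-length p) (Reads⇒Run r)

Reads-++ : ∀ {m t p u m₁ t₁ q v m₂ t₂} → Reads m t p u m₁ t₁ → Reads m₁ t₁ q v m₂ t₂ →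
           Reads m t (p ++ q) (u ++ v) m₂ t₂
Reads-++ []        s = s
Reads-++ (new r)   s = new (Reads-++ r s)
Reads-++ (ret p r) s = ret p (Reads-++ r s)

Reads-++⁻ : ∀ p {m t q w m₂ t₂} → Reads m t (p ++ q) w m₂ t₂ →
            ∃₂ λ u v → ∃₂ λ m₁ t₁ → w ≡ u ++ v × Reads m t p u m₁ t₁ × Reads m₁ t₁ q v m₂ t₂
Reads-++⁻ []          r         = [] , _ , _ , _ , refl , [] , r
Reads-++⁻ (_ ∷ p) (new r)   with Reads-++⁻ p r
... | u , v , m₁ , t₁ , refl , r₁ , r₂ = _ ∷ u , v , m₁ , t₁ , refl , new r₁ , r₂
Reads-++⁻ (_ ∷ p) (ret q r) with Reads-++⁻ p r
... | u , v , m₁ , t₁ , refl , r₁ , r₂ = _ ∷ u , v , m₁ , t₁ , refl , ret q r₁ , r₂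

Run-++ : ∀ {p q d e f} → Run d p e → Run e q f → Run d (p ++ q) f
Run-++ []         s = s
Run-++ (new r)    s = new (Run-++ r s)
Run-++ (ret eq r) s = ret eq (Run-++ r s)

Run-++⁻ : ∀ p {q d f} → Run d (p ++ q) f → ∃ λ e → Run d p e × Run e q f
Run-++⁻ []      r          = _ , [] , r
Run-++⁻ (_ ∷ p) (new r)    with Run-++⁻ p r
... | e , r₁ , r₂ = e , new r₁ , r₂
Run-++⁻ (_ ∷ p) (ret eq r) with Run-++⁻ p r
... | e , r₁ , r₂ = e , ret eq r₁ , r₂

Run-det : ∀ {os d e f} → Run d os e → Run d os f → e ≡ f
Run-det []         []          = refl
Run-det (new r)    (new s)     = Run-det r s
Run-det (ret {j = j} eq r) (ret eq′ s)
  with suc-injective (+-cancelˡ-≡ j _ _ (trans eq (sym eq′)))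
... | refl = Run-det r s

Run-lift : ∀ {os d e} k → Run d os e → Run (d + k) os (e + k)
Run-lift k []                  = []
Run-lift k (new r)             = new (Run-lift k r)
Run-lift k (ret {j = j} {c} refl r) = ret (sym (+-assoc j (suc c) k)) (Run-lift k r)

Run-positive : ∀ {d os e} → Run (suc d) os e → 1 ≤ e
Run-positive []        = s≤s z≤n
Run-positive (new r)   = Run-positive r
Run-positive (ret _ r) = Run-positive r

Run-nonempty : ∀ {d o os e} → Run d (o ∷ os) e → 1 ≤ e
Run-nonempty (new r)   = Run-positive r
Run-nonempty (ret _ r) = Run-positive r

Reads-length : ∀ {m t os w m′ t′} → Reads m t os w m′ t′ → length w ≡ length os
Reads-length []        = refl
Reads-length (new r)   = cong suc (Reads-length r)
Reads-length (ret _ r) = cong suc (Reads-length r)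

-- Either the run never goes below the level a, or it is cut at its last visit to that level.
split-at : ∀ {d os b} a → Run d os (b + a) →
           (∃ λ c → d ≡ c + a × Run c os b) ⊎
           (∃₂ λ p q → os ≡ p ++ q × Run d p a × Run 0 q b)
split-at {b = b} a [] = inj₁ (b , refl , [])
split-at a (new {os = os} r) with split-at a r
... | inj₂ (p , q , refl , r₁ , r₂) = inj₂ (new ∷ p , q , refl , new r₁ , r₂)
-- The rest runs from relative depth zero, so the last visit to level `a` is right after this
-- operation.
... | inj₁ (zero  , refl , s)       = inj₂ (new ∷ [] , os , refl , new [] , s)
... | inj₁ (suc c , refl , s)       = inj₁ (c , refl , new s)
split-at a (ret {j = j} {os = os} eq r) with split-at a r
... | inj₂ (p , q , refl , r₁ , r₂) = inj₂ (ret j ∷ p , q , refl , ret eq r₁ , r₂)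
... | inj₁ (zero  , refl , s)       = inj₂ (ret j ∷ [] , os , refl , ret eq [] , s)
... | inj₁ (suc c , refl , s)       =
  inj₁ (j + suc c , trans (sym eq) (sym (+-assoc j (suc c) a)) , ret refl s)

split : ∀ {os b} a → Run 0 os (b + a) → ∃₂ λ p q → os ≡ p ++ q × Run 0 p a × Run 0 q b
split a r with split-at a r
... | inj₂ s = s
... | inj₁ (zero , refl , s) = [] , _ , refl , [] , s

positive+≢ : ∀ {e a} → 1 ≤ e → e + a ≢ a
positive+≢ {suc e} {a} _ eq = m≢1+n+m a (sym eq)

-- If one cut came earlier, the longer prefix would extend the shorter by a nonempty run from
-- relative depth zero and end strictly above `a`.
split-unique : ∀ {a b b′ d} p p′ {q q′} → p ++ q ≡ p′ ++ q′ →
               Run d p a → Run 0 q b → Run d p′ a → Run 0 q′ b′ → p ≡ p′ × q ≡ q′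
split-unique []      []        refl _ _ _  _  = refl , refl
split-unique []      (o ∷ p′)  refl [] s r′ s′ with Run-++⁻ (o ∷ p′) s
... | e , s₁ , s₂ = contradiction (Run-det (Run-lift _ s₁) r′) (positive+≢ (Run-nonempty s₁))
split-unique (o ∷ p) []        refl r s [] s′ with Run-++⁻ (o ∷ p) s′
... | e , s₁ , s₂ = contradiction (Run-det (Run-lift _ s₁) r) (positive+≢ (Run-nonempty s₁))
split-unique (o ∷ p) (o′ ∷ p′) eq r s r′ s′ with ∷-injective eq
split-unique (_ ∷ p) (_ ∷ p′) eq (new r) s (new r′) s′ | refl , eq′ with split-unique p p′ eq′ r s r′ s′
... | refl , refl = refl , refl
split-unique (_ ∷ p) (_ ∷ p′) eq (ret {j = j} e r) s (ret e′ r′) s′ | refl , eq′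
  with suc-injective (+-cancelˡ-≡ j _ _ (trans e (sym e′)))
... | refl with split-unique p p′ eq′ r s r′ s′
...   | refl , refl = refl , refl

Pop-map : ∀ {j t x t₁} (f : ℕ → ℕ) base → Pop j t x t₁ → Pop j (map f t ++ base) (f x) (map f t₁ ++ base)
Pop-map f base here      = here
Pop-map f base (there p) = there (Pop-map f base p)

-- Returns are counted from the top of the stack, so neither a shift of the letters nor further
-- entries below change the code.
Reads-shift : ∀ {m t os w m′ t′} k base → Reads m t os w m′ t′ →
              Reads (m + k) (map (_+ k) t ++ base) os (map (_+ k) w) (m′ + k) (map (_+ k) t′ ++ base)
Reads-shift k base []        = []
Reads-shift k base (new r)   = new (Reads-shift k base r)
Reads-shift k base (ret p r) = ret (Pop-map (_+ k) base p) (Reads-shift k base r)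

-- The strictly decreasing lists of positive letters not exceeding the bound.
data Stack : ℕ → List ℕ → Set where
  []  : ∀ {b} → Stack b []
  _∷_ : ∀ {b y t} → suc y ≤ b → Stack y t → Stack b (suc y ∷ t)

Stack-mono : ∀ {b c t} → b ≤ c → Stack b t → Stack c t
Stack-mono b≤c []       = []
Stack-mono b≤c (y<b ∷ s) = ≤-trans y<b b≤c ∷ s

Stack-Pop : ∀ {j b t x t₁} → Stack b t → Pop j t x t₁ → Stack b (x ∷ t₁)
Stack-Pop s         here      = s
Stack-Pop (y<b ∷ s) (there p) = Stack-mono (<⇒≤ y<b) (Stack-Pop s p)

Stack-top : ∀ {b x t} → Stack b (x ∷ t) → 1 ≤ x × x ≤ b
Stack-top (x≤b ∷ _) = s≤s z≤n , x≤b

Stack-∈ : ∀ {b t x} → Stack b t → x ∈ t → 1 ≤ x × x ≤ b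
Stack-∈ s@(_ ∷ _) (here refl) = Stack-top s
Stack-∈ (y<b ∷ s) (there x∈t) with Stack-∈ s x∈t
... | 1≤x , x≤y = 1≤x , ≤-trans x≤y (<⇒≤ y<b)

Stack-≤ : ∀ {b t} → Stack b t → All (_≤ b) t
Stack-≤ s = All.tabulate (proj₂ ∘ Stack-∈ s)

Pop-∈ : ∀ {j t x t₁ z} → Pop j t x t₁ → z ∈ x ∷ t₁ → z ∈ t
Pop-∈ here      i = i
Pop-∈ (there p) i = there (Pop-∈ p i)

Stack-new : ∀ {m t} → Stack m t → Stack (suc m) (suc m ∷ t)
Stack-new s = ≤-refl ∷ s

Reads-≤ : ∀ {m t os w m′ t′} → Reads m t os w m′ t′ → m ≤ m′
Reads-≤ []        = ≤-refl
Reads-≤ (new r)   = ≤-trans (n≤1+n _) (Reads-≤ r)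
Reads-≤ (ret _ r) = Reads-≤ r

Reads-Stack : ∀ {m t os w m′ t′} → Stack m t → Reads m t os w m′ t′ → Stack m′ t′
Reads-Stack s []        = s
Reads-Stack s (new r)   = Reads-Stack (Stack-new s) r
Reads-Stack s (ret p r) = Reads-Stack (Stack-Pop s p) r

Reads-maxLetter : ∀ {m t os w m′ t′} → Stack m t → Reads m t os w m′ t′ → m′ ≡ m ⊔ maxLetter w
Reads-maxLetter s []        = sym (⊔-identityʳ _)
Reads-maxLetter {m} s (new {w = w} r) = begin
  _                         ≡⟨ Reads-maxLetter (Stack-new s) r ⟩
  suc m ⊔ maxLetter w       ≡⟨ cong (_⊔ maxLetter w) (m≤n⇒m⊔n≡n (n≤1+n m)) ⟨
  m ⊔ suc m ⊔ maxLetter w   ≡⟨ ⊔-assoc m (suc m) (maxLetter w) ⟩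
  m ⊔ (suc m ⊔ maxLetter w) ∎
  where open ≡-Reasoning
Reads-maxLetter {m} s (ret {x = x} {w = w} p r) = begin
  _                     ≡⟨ Reads-maxLetter s′ r ⟩
  m ⊔ maxLetter w       ≡⟨ cong (_⊔ maxLetter w) (m≥n⇒m⊔n≡m (proj₂ (Stack-top s′))) ⟨
  m ⊔ x ⊔ maxLetter w   ≡⟨ ⊔-assoc m x (maxLetter w) ⟩
  m ⊔ (x ⊔ maxLetter w) ∎
  where
  open ≡-Reasoning
  s′ = Stack-Pop s p

Reads-canonical : ∀ {m t os w m′ t′} → Stack m t → Reads m t os w m′ t′ → RestrictedGrowth m w
Reads-canonical s []                = []
Reads-canonical {m} s (new {w = w} r) = cons (s≤s z≤n) ≤-refl
  (subst (λ k → RestrictedGrowth k w) (sym (m≤n⇒m⊔n≡n (n≤1+n m))) (Reads-canonical (Stack-new s) r))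
Reads-canonical {m} s (ret {w = w} p r) with Stack-top (Stack-Pop s p)
... | 1≤x , x≤m = cons 1≤x (m≤n⇒m≤1+n x≤m)
  (subst (λ k → RestrictedGrowth k w) (sym (m≥n⇒m⊔n≡m x≤m)) (Reads-canonical (Stack-Pop s p) r))

canonical-positive : ∀ {m w} → RestrictedGrowth m w → All (1 ≤_) w
canonical-positive []             = []
canonical-positive (cons 1≤x _ g) = 1≤x ∷ canonical-positive g

letters≤maxLetter : ∀ w → All (_≤ maxLetter w) w
letters≤maxLetter []      = []
letters≤maxLetter (x ∷ w) =
  m≤m⊔n x (maxLetter w) ∷ All.map (λ y≤ → ≤-trans y≤ (m≤n⊔m x (maxLetter w))) (letters≤maxLetter w)

-- `new` writes letters above `m` and `ret` letters of the stack, so a letter once discarded is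
-- lost.
closed-∉ : ∀ {m t os w m′ t′ z} → Stack m t → Reads m t os w m′ t′ → z ≤ m → z ∉ t → z ∉ w
closed-∉ s (new r) z≤m z∉t (here refl) = n≮n _ z≤m
closed-∉ s (new r) z≤m z∉t (there z∈w) = closed-∉ (Stack-new s) r (m≤n⇒m≤1+n z≤m)
  (λ { (here refl) → n≮n _ z≤m ; (there z∈t) → z∉t z∈t }) z∈w
closed-∉ s (ret p r) z≤m z∉t (here refl) = z∉t (Pop-∈ p (here refl))
closed-∉ s (ret p r) z≤m z∉t (there z∈w) = closed-∉ (Stack-Pop s p) r z≤m (z∉t ∘ Pop-∈ p) z∈w

larger-∉ : ∀ {b x t y} → Stack b (x ∷ t) → x < y → y ∉ x ∷ t
larger-∉ (_ ∷ s) x<y (here refl) = n≮n _ x<y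
larger-∉ (_ ∷ s) x<y (there y∈t) = <-asym x<y (s≤s (proj₂ (Stack-∈ s y∈t)))

-- Writing the smaller `a` leaves no `b` on the stack. This is the last stage of a forbidden `abab`;
-- `no-bab` and `no-abab` go back to the stages where `b` is still to be introduced and where
-- nothing has been read yet.
no-ab : ∀ {m t os w m′ t′ a b} → Stack m t → Reads m t os w m′ t′ → a < b → b ≤ m →
        ¬ (a ∷ b ∷ [] ⊆ w)
no-ab s (new r)   a<b b≤m (_ ∷ʳ q)   = no-ab (Stack-new s) r a<b (m≤n⇒m≤1+n b≤m) q
no-ab s (ret p r) a<b b≤m (_ ∷ʳ q)   = no-ab (Stack-Pop s p) r a<b b≤m q
no-ab s (new r)   a<b b≤m (refl ∷ q) = n≮n _ (<-≤-trans a<b (m≤n⇒m≤1+n b≤m))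
no-ab s (ret p r) a<b b≤m (refl ∷ q) =
  closed-∉ (Stack-Pop s p) r b≤m (larger-∉ (Stack-Pop s p) a<b) (to∈ q)

no-bab : ∀ {m t os w m′ t′ a b} → Stack m t → Reads m t os w m′ t′ → a < b → m < b →
         ¬ (b ∷ a ∷ b ∷ [] ⊆ w)
no-bab s (ret p r) a<b m<b (_ ∷ʳ q)   = no-bab (Stack-Pop s p) r a<b m<b q
no-bab s (ret p r) a<b m<b (refl ∷ q) = n≮n _ (<-≤-trans m<b (proj₂ (Stack-top (Stack-Pop s p))))
no-bab s (new r)   a<b m<b (refl ∷ q) = no-ab (Stack-new s) r a<b ≤-refl q
no-bab {m} {b = b} s (new r) a<b m<b (_ ∷ʳ q) with m≤n⇒m<n∨m≡n m<b
... | inj₁ 1+m<b = no-bab (Stack-new s) r a<b 1+m<b q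
... | inj₂ refl  = no-ab (Stack-new s) r a<b ≤-refl (Sublist.∷ˡ⁻ q)

no-abab : ∀ {m t os w m′ t′ a b} → Stack m t → Reads m t os w m′ t′ → a < b →
          ¬ (a ∷ b ∷ a ∷ b ∷ [] ⊆ w)
no-abab s (new r)   a<b (_ ∷ʳ q)   = no-abab (Stack-new s) r a<b q
no-abab s (ret p r) a<b (_ ∷ʳ q)   = no-abab (Stack-Pop s p) r a<b q
no-abab s (new r)   a<b (refl ∷ q) = no-bab (Stack-new s) r a<b a<b q
no-abab {m} {b = b} s (ret p r) a<b (refl ∷ q) with ≤-<-connex b m
... | inj₁ b≤m = no-ab (Stack-Pop s p) r a<b b≤m (Sublist.∷ˡ⁻ q)
... | inj₂ m<b = no-bab (Stack-Pop s p) r a<b m<b q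

Reads-nonCrossing : ∀ {os w m t} → Reads 0 [] os w m t → ¬ Occurs (word crossing) w
Reads-nonCrossing r o with crossing-occurs⁻ o
... | a , b , a<b , q = no-abab [] r a<b q

-- Uniqueness and existence of the code of a word

Pop-index : ∀ {i j b t x t₁ t₂} → Stack b t → Pop i t x t₁ → Pop j t x t₂ → i ≡ j
Pop-index s       here      here      = refl
Pop-index (_ ∷ s) (there p) (there q) = cong suc (Pop-index s p q)
Pop-index (_ ∷ s) here      (there q) = contradiction (proj₂ (Stack-∈ s (Pop-∈ q (here refl)))) (n≮n _)
Pop-index (_ ∷ s) (there q) here      = contradiction (proj₂ (Stack-∈ s (Pop-∈ q (here refl)))) (n≮n _)

-- Each letter reveals its operation: above `m` it is new, otherwise it is a return, whose index is
-- determined because the stack has no repeated letter.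
Reads-injective : ∀ {m t os os′ w m₁ t₁ m₂ t₂} → Stack m t →
                  Reads m t os w m₁ t₁ → Reads m t os′ w m₂ t₂ → os ≡ os′
Reads-injective s []        []        = refl
Reads-injective s (new r)   (new r′)  = cong (new ∷_) (Reads-injective (Stack-new s) r r′)
Reads-injective s (new r)   (ret p _) = contradiction (proj₂ (Stack-top (Stack-Pop s p))) (n≮n _)
Reads-injective s (ret p _) (new _)   = contradiction (proj₂ (Stack-top (Stack-Pop s p))) (n≮n _)
Reads-injective s (ret p r) (ret q r′) with Pop-index s p q
... | refl with Pop-det p q
... | refl , refl = cong (_ ∷_) (Reads-injective (Stack-Pop s p) r r′)

∈-Pop : ∀ {x t} → x ∈ t → ∃₂ λ j t₁ → Pop j t x t₁
∈-Pop (here refl) = 0 , _ , here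
∈-Pop (there x∈t) with ∈-Pop x∈t
... | j , t₁ , p = suc j , t₁ , there p

∈-Pop-kept : ∀ {j b t x t₁ z} → Stack b t → Pop j t x t₁ → z ∈ t → z ≤ x → z ∈ x ∷ t₁
∈-Pop-kept s       here      z∈t         z≤x = z∈t
∈-Pop-kept (_ ∷ s) (there p) (there z∈t) z≤x = ∈-Pop-kept s p z∈t z≤x
∈-Pop-kept (_ ∷ s) (there p) (here refl) z≤x =
  contradiction (≤-trans z≤x (proj₂ (Stack-∈ s (Pop-∈ p (here refl))))) (n≮n _)

-- closed, ab, bab and abab forbid the rests that would complete a crossing begun by the prefix.
parse : ∀ {m t w} → Stack m t → RestrictedGrowth m w →
        (∀ {z} → 1 ≤ z → z ≤ m → z ∉ t → z ∉ w) →
        (∀ {a b} → 1 ≤ a → a < b → b ≤ m → ¬ (a ∷ b ∷ [] ⊆ w)) →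
        (∀ {a b} → 1 ≤ a → a ≤ m → m < b → ¬ (b ∷ a ∷ b ∷ [] ⊆ w)) →
        (∀ {a b} → a < b → ¬ (a ∷ b ∷ a ∷ b ∷ [] ⊆ w)) →
        ∃₂ λ os m′ → ∃ λ t′ → Reads m t os w m′ t′
parse s [] closed ab bab abab = [] , _ , _ , []
parse {m} {t} s (cons {x} {w} 1≤x x≤1+m g) closed ab bab abab with m≤n⇒m<n∨m≡n x≤1+m
... | inj₂ refl
  with parse (Stack-new s) (subst (λ k → RestrictedGrowth k w) (m≤n⇒m⊔n≡n (n≤1+n m)) g)
         closed′ ab′ bab′
         (λ a<b q → abab a<b (_ ∷ʳ q))
  where
  closed′ : ∀ {z} → 1 ≤ z → z ≤ suc m → z ∉ suc m ∷ t → z ∉ w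
  closed′ 1≤z z≤1+m z∉ z∈w with m≤n⇒m<n∨m≡n z≤1+m
  ... | inj₁ (s≤s z≤m) = closed 1≤z z≤m (z∉ ∘ there) (there z∈w)
  ... | inj₂ refl      = z∉ (here refl)
  -- If the letter just read is the `b` of `ab`, or the `a` of `bab` below, it is put in front and
  -- the next longer pattern is refuted.
  ab′ : ∀ {a b} → 1 ≤ a → a < b → b ≤ suc m → ¬ (a ∷ b ∷ [] ⊆ w)
  ab′ 1≤a a<b b≤1+m q with m≤n⇒m<n∨m≡n b≤1+m
  ... | inj₁ (s≤s b≤m) = ab 1≤a a<b b≤m (_ ∷ʳ q)
  ... | inj₂ refl      = bab 1≤a (≤-pred a<b) ≤-refl (refl ∷ q)
  bab′ : ∀ {a b} → 1 ≤ a → a ≤ suc m → suc m < b → ¬ (b ∷ a ∷ b ∷ [] ⊆ w)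
  bab′ 1≤a a≤1+m 1+m<b q with m≤n⇒m<n∨m≡n a≤1+m
  ... | inj₁ (s≤s a≤m) = bab 1≤a a≤m (<-trans (n<1+n m) 1+m<b) (_ ∷ʳ q)
  ... | inj₂ refl      = abab 1+m<b (refl ∷ q)
...   | os , m′ , t′ , r = new ∷ os , m′ , t′ , new r
parse {m} {t} s (cons {x} {w} 1≤x _ g) closed ab bab abab | inj₁ (s≤s x≤m) with x ∈? t
  where open import Data.List.Membership.DecPropositional _≟_ using (_∈?_)
... | no x∉t  = contradiction (here refl) (closed 1≤x x≤m x∉t)
... | yes x∈t with ∈-Pop x∈t
...   | j , t₁ , p
  with parse (Stack-Pop s p) (subst (λ k → RestrictedGrowth k w) (m≥n⇒m⊔n≡m x≤m) g)
         closed′ (λ 1≤a a<b b≤m q → ab 1≤a a<b b≤m (_ ∷ʳ q))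
         (λ 1≤a a≤m m<b q → bab 1≤a a≤m m<b (_ ∷ʳ q)) (λ a<b q → abab a<b (_ ∷ʳ q))
  where
  closed′ : ∀ {z} → 1 ≤ z → z ≤ m → z ∉ x ∷ t₁ → z ∉ w
  closed′ {z} 1≤z z≤m z∉ z∈w with ≤-<-connex z x
  ... | inj₁ z≤x = closed 1≤z z≤m (λ z∈t → z∉ (∈-Pop-kept s p z∈t z≤x)) (there z∈w)
  -- Such a `z` may have been discarded only now; its return would form the pattern `x z`.
  ... | inj₂ x<z = ab 1≤x x<z z≤m (refl ∷ from∈ z∈w)
...     | os , m′ , t′ , r = ret j ∷ os , m′ , t′ , ret p r

encode : ∀ {w} → RestrictedGrowth 0 w → ¬ Occurs (word crossing) w →
         ∃₂ λ os m → ∃ λ t → Reads 0 [] os w m t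
encode g nc = parse [] g (λ { (s≤s _) () }) (λ { 1≤a (s≤s _) () })
  (λ { (s≤s _) () }) (λ a<b q → nc (crossing-occurs a<b q))

-- Components

record Decodes (os : Code) (w : List ℕ) (d : ℕ) : Set where
  constructor decodes
  field
    {top}   : ℕ
    {stack} : List ℕ
    reads   : Reads 0 [] os w top stack
    depth   : length stack ≡ d

decode : ∀ {os d} → Run 0 os d → ∃ λ w → Decodes os w d
decode r with Run⇒Reads 0 [] r
... | w , _ , _ , r′ , eq = w , decodes r′ eq

Decodes⇒Run : ∀ {os w d} → Decodes os w d → Run 0 os d
Decodes⇒Run (decodes r refl) = Reads⇒Run r

Decodes-det : ∀ {os v w d e} → Decodes os v d → Decodes os w e → v ≡ w × d ≡ e
Decodes-det (decodes r refl) (decodes r′ refl) with Reads-det r r′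
... | refl , refl , refl = refl , refl

Decodes-injective : ∀ {os os′ w d e} → Decodes os w d → Decodes os′ w e → os ≡ os′ × d ≡ e
Decodes-injective c@(decodes r refl) c′@(decodes r′ refl) with Reads-injective [] r r′
... | refl = refl , proj₂ (Decodes-det c c′)

-- The second code runs above the stack left by the first, whose number of letters is `maxLetter u`,
-- the shift used in `_[_]`.
Decodes-product : ∀ {p q u v d e} → Decodes p u d → Decodes q v e →
                  Decodes (p ++ q) (u ++ map (_+ maxLetter u) v) (e + d)
Decodes-product (decodes {stack = t} r refl) (decodes {stack = t′} r′ refl)
  with Reads-maxLetter [] r
... | refl = decodes (Reads-++ r (Reads-shift _ t r′))
  (trans (length-++ (map _ t′)) (cong (_+ length t) (length-map _ t′)))

Decodes-nonCrossing : ∀ {os w d} → Decodes os w d → ¬ Occurs (word crossing) w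
Decodes-nonCrossing (decodes r _) = Reads-nonCrossing r

partition : ∀ {os w d} → Decodes os w d → Partition
partition {w = w} (decodes r _) = mkPartition w (Reads-canonical [] r)

encodePartition : ∀ π → ¬ Occurs (word crossing) (word π) → ∃₂ λ os d → Decodes os (word π) d
encodePartition π nc with encode (canonical π) nc
... | os , _ , t , r = os , length t , decodes r refl

encodeNonCrossing : ∀ π → NonCrossing π → ∃₂ λ os d → Decodes os (word π) d
encodeNonCrossing π nc = encodePartition π (nc ∘ Occurs⇒Contains {π} {crossing})

Decodes⇒NonCrossing : ∀ {os d} π → Decodes os (word π) d → NonCrossing π
Decodes⇒NonCrossing π c = Decodes-nonCrossing c ∘ Contains⇒Occurs {π} {crossing}

product-nonCrossing : ∀ α β → NonCrossing α → NonCrossing β → NonCrossing (α [ β ])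
product-nonCrossing α β ncα ncβ with encodeNonCrossing α ncα | encodeNonCrossing β ncβ
... | _ , _ , cα | _ , _ , cβ = Decodes⇒NonCrossing (α [ β ]) (Decodes-product cα cβ)

nonempty-depth : ∀ {os w d} → w ≢ [] → Decodes os w d → ∃ λ e → d ≡ suc e
nonempty-depth         w≢[] (decodes [] _) = contradiction refl w≢[]
nonempty-depth {d = zero}  _ c@(decodes {os} (new r) _) with Run-nonempty (Decodes⇒Run c)
... | ()
nonempty-depth {d = suc e} _ _ = e , refl
nonempty-depth {d = zero}  _ c@(decodes (ret _ _) _) with Run-nonempty (Decodes⇒Run c)
... | ()

depth-nonempty : ∀ {os w d} → Decodes os w (suc d) → w ≢ []
depth-nonempty (decodes [] ()) refl

-- The cut of a code at its last visit to depth a is the cut of the word after a components.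
cut : ∀ {os w} a b → Decodes os w (b + a) →
      ∃₂ λ p q → ∃₂ λ u v → os ≡ p ++ q × Decodes p u a × Decodes q v b ×
      w ≡ u ++ map (_+ maxLetter u) v
cut a b c with split a (Decodes⇒Run c)
... | p , q , refl , r₁ , r₂ with decode r₁ | decode r₂
... | u , c₁ | v , c₂ =
  p , q , u , v , refl , c₁ , c₂ , proj₁ (Decodes-det c (Decodes-product c₁ c₂))

-- At depth two or more, the cut at the last visit to depth one would be a proper factorization.
connected-depth : ∀ {os d} π → Nonempty π → Connected π → Decodes os (word π) d → d ≡ 1
connected-depth π ne conn c with nonempty-depth ne c
... | zero  , refl = refl
... | suc e , refl with cut 1 (suc e) (subst (Decodes _ _) (sym (+-comm (suc e) 1)) c)
... | p , q , u , v , _ , c₁ , c₂ , eq =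
  contradiction (partition c₁ , partition c₂ , depth-nonempty c₁ , depth-nonempty c₂ , eq) conn

-- Both factors occur in the product, so they are non-crossing and have codes; uniqueness identifies
-- `os` with their concatenation.
product-depth : ∀ {os d} α β → Decodes os (word (α [ β ])) d →
                ∃₂ λ p a → ∃₂ λ q b → Decodes p (word α) a × Decodes q (word β) b × d ≡ b + a
product-depth α β c
  with encodePartition α (Decodes-nonCrossing c ∘ Occurs-⊆ (Sublist.++⁺ʳ _ ⊆-refl))
     | encodePartition β (Decodes-nonCrossing c ∘ Occurs-⊆ (Sublist.++⁺ˡ (word α) ⊆-refl) ∘
                          Occurs-shift⁺ (blocks α) (word β))
... | p , a , c₁ | q , b , c₂ =
  p , a , q , b , c₁ , c₂ , proj₂ (Decodes-injective c (Decodes-product c₁ c₂))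

depth-connected : ∀ {os} π → Decodes os (word π) 1 → Connected π
depth-connected π c (α , β , neα , neβ , eq)
  with product-depth α β (subst (λ w → Decodes _ w 1) eq c)
... | p , a , q , b , c₁ , c₂ , 1≡b+a
  with nonempty-depth neα c₁ | nonempty-depth neβ c₂
... | a′ , refl | b′ , refl with trans 1≡b+a (+-suc (suc b′) a′)
...   | ()

componentCount : ∀ {os d} π σs → AreComponentsOf σs π → Decodes os (word π) d → length σs ≡ d
componentCount π σs (alls , eq) c = go σs alls (subst (λ w → Decodes _ w _) eq c)
  where
  go : ∀ {os d} σs → All (λ σ → Nonempty σ × Connected σ) σs →
       Decodes os (word (compose σs)) d → length σs ≡ d
  go []       []                   (decodes [] eq) = eq
  go (σ ∷ σs) ((ne , conn) ∷ alls) c with product-depth σ (compose σs) c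
  ... | p , a , q , b , c₁ , c₂ , refl with connected-depth σ ne conn c₁
  ...   | refl = trans (cong suc (go σs alls c₂)) (+-comm 1 b)

components : ∀ {os} d π → Decodes os (word π) d → HasComponents π d
components d π c with go d c
  where
  go : ∀ {os w} d → Decodes os w d → ∃ λ σs →
       All (λ σ → Nonempty σ × Connected σ) σs × w ≡ word (compose σs) × length σs ≡ d
  go zero    (decodes [] _)            = [] , [] , refl , refl
  go zero  c@(decodes (new _) _) with Run-nonempty (Decodes⇒Run c)
  ... | ()
  go zero  c@(decodes (ret _ _) _) with Run-nonempty (Decodes⇒Run c)
  ... | ()
  -- The part up to the last visit to depth one is the first component.
  go (suc d) c with cut 1 d (subst (Decodes _ _) (+-comm 1 d) c)
  ... | p , q , u , v , _ , c₁ , c₂ , refl with go d c₂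
  ...   | σs , alls , refl , eq =
    σ ∷ σs , (depth-nonempty c₁ , depth-connected σ c₁) ∷ alls , refl , cong suc eq
    where σ = partition c₁
... | σs , alls , eq , len = σs , (alls , eq) , len

-- Reduces preservation of the number of components to preservation of the final depth.
HasComponents⇔depth : ∀ {os d} π m → Decodes os (word π) d → HasComponents π m ⇔ m ≡ d
HasComponents⇔depth {d = d} π m c = mk⇔
  (λ (σs , are , len) → trans (sym len) (componentCount π σs are c))
  (λ { refl → components d π c })

-- Containment of products

-- gap c k: after an inner stretch opening c components, return to the letter with k letters
-- above it among those accessible before the suffix.
data Skeleton : Set where
  end : ℕ → Skeleton
  gap : ℕ → ℕ → Skeleton → Skeleton

-- Fill sk s n: deleting from s the returns to letters older than s, which sk records,
-- leaves n.
data Fill : Skeleton → Code → Code → Set where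
  end : ∀ {n c} → Run 0 n c → Fill (end c) n n
  gap : ∀ {p c k sk s n} → Run 0 p c → Fill sk s n →
        Fill (gap c k sk) (p ++ ret (k + c) ∷ s) (p ++ n)

total : Skeleton → ℕ
total (end c)      = c
total (gap c _ sk) = total sk + c

Fill⇒Run : ∀ {sk s n} → Fill sk s n → Run 0 n (total sk)
Fill⇒Run (end r)           = r
Fill⇒Run (gap {c = c} r f) = Run-++ r (Run-lift c (Fill⇒Run f))

-- The accumulator `p` is the inner stretch read so far, of depth `c`. A `ret j` stays inside it
-- exactly when `j < c`; otherwise it closes the stretch and becomes a gap.
skeletonFrom : ∀ {p c} → Run 0 p c → ∀ s → ∃₂ λ sk n → Fill sk (p ++ s) n
skeletonFrom {p} r []         = _ , _ , subst (λ s → Fill _ s p) (sym (++-identityʳ p)) (end r)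
skeletonFrom {p} {c} r (new ∷ s) with skeletonFrom (Run-++ r (new [])) s
... | sk , n , f = sk , n , subst (λ s → Fill sk s n) (++-assoc p (new ∷ []) s) f
skeletonFrom {p} {c} r (ret j ∷ s) with j <? c
... | no j≮c with skeletonFrom [] s
...   | sk , n , f = gap c (j ∸ c) sk , p ++ n ,
  subst (λ i → Fill (gap c (j ∸ c) sk) (p ++ ret i ∷ s) (p ++ n)) (m∸n+n≡m (≮⇒≥ j≮c)) (gap r f)
skeletonFrom {p} {c} r (ret j ∷ s) | yes j<c with m≤n⇒∃[o]m+o≡n j<c
... | c′ , eq with skeletonFrom (Run-++ r (ret (trans (+-suc j c′) eq) [])) s
...   | sk , n , f = sk , n , subst (λ s → Fill sk s n) (++-assoc p (ret j ∷ []) s) f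

skeleton : ∀ s → ∃₂ λ sk n → Fill sk s n
skeleton = skeletonFrom []

-- A return to an older letter discards all inner letters on the stack, so its place in the inner
-- code is the last visit to the recorded depth. Hence any inner code of the right total depth fits
-- the skeleton.
refill : ∀ {n} sk → Run 0 n (total sk) → ∃ λ s → Fill sk s n
refill (end c)      r = _ , end r
refill (gap c k sk) r with split c r
... | p , q , refl , r₁ , r₂ with refill sk r₂
... | s , f = p ++ ret (k + c) ∷ s , gap r₁ f

no-old-return : ∀ {d p c k s e} → Run d p c → ¬ Run d (p ++ ret (k + c) ∷ s) e
no-old-return {p = p} {c} {k} r r′ with Run-++⁻ p r′
... | _ , r₁ , ret {c = c′} eq _ with Run-det r r₁
... | refl = m≢1+n+m c (trans (sym eq) (trans (+-suc (k + c) c′)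
      (cong suc (trans (+-comm (k + c) c′) (sym (+-assoc c′ k c))))))

-- The first return reaching below the inner stack is visible in the code: a longer stretch would
-- have to contain it, against `no-old-return`.
first-gap-unique : ∀ {d c c′ k k′ s s′} p p′ → Run d p c → Run d p′ c′ →
                   p ++ ret (k + c) ∷ s ≡ p′ ++ ret (k′ + c′) ∷ s′ →
                   p ≡ p′ × c ≡ c′ × k ≡ k′ × s ≡ s′
first-gap-unique {c = c} {k = k} {k′} [] [] [] [] eq with ∷-injective eq
... | eq₁ , refl = refl , refl , +-cancelʳ-≡ c k k′ (ret-injective eq₁) , refl
  where
  ret-injective : ∀ {i j} → ret i ≡ ret j → i ≡ j
  ret-injective refl = refl
first-gap-unique {k = k} [] (_ ∷ p′) [] r′ eq with ∷-injective eq
... | refl , refl = contradiction r′ (no-old-return {k = k} [])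
first-gap-unique {k′ = k′} (_ ∷ p) [] r [] eq with ∷-injective eq
... | refl , refl = contradiction r (no-old-return {k = k′} [])
first-gap-unique (_ ∷ p) (_ ∷ p′) r r′ eq with ∷-injective eq
first-gap-unique (_ ∷ p) (_ ∷ p′) (new r) (new r′) _ | refl , eq with first-gap-unique p p′ r r′ eq
... | refl , rest = refl , rest
first-gap-unique (_ ∷ p) (_ ∷ p′) (ret {j = j} e r) (ret e′ r′) _ | refl , eq
  with suc-injective (+-cancelˡ-≡ j _ _ (trans e (sym e′)))
... | refl with first-gap-unique p p′ r r′ eq
...   | refl , rest = refl , rest

skeleton-unique : ∀ {sk sk′ s s′ n n′} → Fill sk s n → Fill sk′ s′ n′ → s ≡ s′ → sk ≡ sk′ × n ≡ n′
skeleton-unique (end r) (end r′) refl with Run-det r r′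
... | refl = refl , refl
skeleton-unique (end r) (gap {k = k} r′ _) refl = contradiction r (no-old-return {k = k} r′)
skeleton-unique (gap {k = k} r _) (end r′) refl = contradiction r′ (no-old-return {k = k} r)
skeleton-unique (gap {p} r f) (gap {p′} r′ f′) eq with first-gap-unique p p′ r r′ eq
... | refl , refl , refl , eq′ with skeleton-unique f f′ eq′
... | refl , refl = refl , refl

refill-unique : ∀ {sk s s′ n n′} → Fill sk s n → Fill sk s′ n′ → n ≡ n′ → s ≡ s′
refill-unique (end _)       (end _)         eq = eq
refill-unique (gap {p} r f) (gap {p′} r′ f′) eq
  with split-unique p p′ eq r (Fill⇒Run f) r′ (Fill⇒Run f′)
... | refl , eq′ = cong (λ s → p ++ _ ∷ s) (refill-unique f f′ eq′)

-- Corresponding inner stretches open equally many components, so every restored return meets a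
-- stack of the same depth as before.
refill-run : ∀ {sk s s′ n n′ d e} → Fill sk s n → Fill sk s′ n′ → Run d s e → Run d s′ e
refill-run {d = d} (end r) (end r′) r₀ with Run-det (Run-lift d r) r₀
... | refl = Run-lift d r′
refill-run {d = d} (gap {p} r f) (gap r′ f′) r₀ with Run-++⁻ p r₀
... | _ , r₁ , ret eq r₂ with Run-det (Run-lift d r) r₁
... | refl = Run-++ (Run-lift d r′) (ret eq (refill-run f f′ r₂))

gaps : Skeleton → ℕ
gaps (end _)      = 0
gaps (gap _ _ sk) = suc (gaps sk)

Fill-length : ∀ {sk s n} → Fill sk s n → length s ≡ gaps sk + length n
Fill-length (end _) = refl
Fill-length (gap {p} {c} {k} {sk} {s} {n} r f) = begin
  length (p ++ ret (k + c) ∷ s)           ≡⟨ length-++ p ⟩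
  length p + suc (length s)               ≡⟨ +-suc (length p) (length s) ⟩
  suc (length p + length s)               ≡⟨ cong (λ l → suc (length p + l)) (Fill-length f) ⟩
  suc (length p + (gaps sk + length n))   ≡⟨ cong suc (x∙yz≈y∙xz (length p) (gaps sk) (length n)) ⟩
  suc (gaps sk + (length p + length n))   ≡⟨ cong (λ l → suc (gaps sk + l)) (length-++ p) ⟨
  suc (gaps sk + length (p ++ n))         ∎
  where
  open ≡-Reasoning
  open import Algebra.Properties.CommutativeSemigroup +-commutativeSemigroup using (x∙yz≈y∙xz)

Pop-drop : ∀ {i k x t₂ base} t → i ≡ length t + k → Pop i (t ++ base) x t₂ → Pop k base x t₂
Pop-drop []      refl q         = q
Pop-drop (_ ∷ t) eq   (there q) = Pop-drop t (suc-injective eq) q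

shifted-above : ∀ {b m v} → b ≤ m → All (1 ≤_) v → All (b <_) (map (_+ m) v)
shifted-above {m = m} b≤m pos = All.map⁺ (All.map (λ 1≤x → ≤-trans (s≤s b≤m) (+-monoˡ-≤ m 1≤x)) pos)

Reads-positive : ∀ {os w m t} → Reads 0 [] os w m t → All (1 ≤_) w
Reads-positive r = canonical-positive (Reads-canonical [] r)

-- The deleted returns write letters of `base`, all at most `b`, while the other operations write
-- letters above `m`. The threshold `b` is separate from `m` because it stays fixed while the number
-- of letters grows in the recursion.
letters-above : ∀ {sk s n b m base w m′ t′ v l t} → b ≤ m → All (_≤ b) base →
                Fill sk s n → Reads m base s w m′ t′ → Reads 0 [] n v l t →
                filter (b <?_) w ≡ map (_+ m) v
letters-above {b = b} {m} {base} b≤m base≤b (end _) r rᵥ with Reads-det r (Reads-shift m base rᵥ)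
... | refl , _ = filter-all (b <?_) (shifted-above b≤m (Reads-positive rᵥ))
letters-above {b = b} {m} {base} b≤m base≤b (gap {p} {c} {k} rₚ f) r rᵥ
  with Reads-++⁻ p r | Reads-++⁻ p rᵥ | decode (Fill⇒Run f)
... | u , _ , _ , _ , refl , r₁ , ret {x = x} {w = w₂} pop r₂
    | v₁ , _ , l₁ , t₁ , refl , rᵥ₁ , rᵥ₂
    | v₂ , decodes rₙ _
  with Reads-det r₁ (Reads-shift m base rᵥ₁) | Reads-det rᵥ₂ (Reads-shift l₁ t₁ rₙ)
     | Run-det rₚ (Reads⇒Run rᵥ₁)
... | refl , refl , refl | refl , _ | refl = begin
  filter (b <?_) (map (_+ m) v₁ ++ x ∷ w₂)
    ≡⟨ filter-++ (b <?_) (map (_+ m) v₁) (x ∷ w₂) ⟩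
  filter (b <?_) (map (_+ m) v₁) ++ filter (b <?_) (x ∷ w₂)
    ≡⟨ cong₂ _++_ (filter-all (b <?_) (shifted-above b≤m (Reads-positive rᵥ₁)))
                  (filter-reject (b <?_) (≤⇒≯ (All.head kept))) ⟩
  map (_+ m) v₁ ++ filter (b <?_) w₂
    ≡⟨ cong (map (_+ m) v₁ ++_) (letters-above (≤-trans b≤m (m≤n+m m l₁)) kept f r₂ rₙ) ⟩
  map (_+ m) v₁ ++ map (_+ (l₁ + m)) v₂
    ≡⟨ cong (map (_+ m) v₁ ++_) (map-cong (λ y → sym (+-assoc y l₁ m)) v₂) ⟩
  map (_+ m) v₁ ++ map (λ y → y + l₁ + m) v₂
    ≡⟨ cong (map (_+ m) v₁ ++_) (map-∘ v₂) ⟩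
  map (_+ m) v₁ ++ map (_+ m) (map (_+ l₁) v₂)
    ≡⟨ map-++ (_+ m) v₁ (map (_+ l₁) v₂) ⟨
  map (_+ m) (v₁ ++ map (_+ l₁) v₂) ∎
  where
  open ≡-Reasoning
  -- `ret (k + c)` first discards the `c` inner letters, so what remains comes from `base`.
  kept : All (_≤ b) (x ∷ _)
  kept = All.tabulate (All.lookup base≤b ∘ Pop-∈ (Pop-drop (map (_+ m) t₁)
           (trans (+-comm k c) (cong (_+ k) (sym (length-map (_+ m) t₁)))) pop))

-- Occurrences in codes and the cut between two factors

record CodeOccurs (t : List ℕ) (os : Code) : Set where
  constructor codeOccurs
  field
    {letters} : List ℕ
    {top}     : ℕ
    {stack}   : List ℕ
    reads     : Reads 0 [] os letters top stack
    occurring : Occurs t letters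

record InnerOccurs (t : List ℕ) (s : Code) : Set where
  constructor innerOccurs
  field
    {shape} : Skeleton
    {inner} : Code
    fill    : Fill shape s inner
    occurring : CodeOccurs t inner

innerOccurs⁺ : ∀ {t s m base w m′ t′ b} → b ≤ m → All (_≤ b) base → Reads m base s w m′ t′ →
               Occurs t (filter (b <?_) w) → InnerOccurs t s
innerOccurs⁺ {s = s} {m} b≤m base≤b r o with skeleton s
... | sk , n , f with decode (Fill⇒Run f)
... | v , decodes rᵥ _ = innerOccurs f
  (codeOccurs rᵥ (Occurs-shift⁻ m v (subst (Occurs _) (letters-above b≤m base≤b f r rᵥ) o)))

innerOccurs⁻ : ∀ {t s m base w m′ t′ b} → b ≤ m → All (_≤ b) base → Reads m base s w m′ t′ →
               InnerOccurs t s → Occurs t (filter (b <?_) w)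
innerOccurs⁻ {m = m} b≤m base≤b r (innerOccurs f (codeOccurs rᵥ o)) =
  subst (Occurs _) (sym (letters-above b≤m base≤b f r rᵥ)) (Occurs-shift⁺ m _ o)

-- Starting the suffix earlier only enlarges its set of new letters: a letter above `m₁` is also
-- above `m`.
innerOccurs-++ : ∀ {t m base w m′ t′} q {s} → Stack m base → Reads m base (q ++ s) w m′ t′ →
                 InnerOccurs t s → InnerOccurs t (q ++ s)
innerOccurs-++ {m = m} q st r o with Reads-++⁻ q r
... | u , v , m₁ , t₁ , refl , r₁ , r₂ =
  innerOccurs⁺ ≤-refl (Stack-≤ st) r
    (Occurs-⊆ (⊆-trans (Sublist.filter⁺ (m₁ <?_) (m <?_) (λ { refl m₁<x → ≤-<-trans (Reads-≤ r₁) m₁<x }) (⊆-refl {x = v}))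
                (⊆-trans (Sublist.++⁺ˡ (filter (m <?_) u) ⊆-refl)
                  (⊆-reflexive (sym (filter-++ (m <?_) u v)))))
      (innerOccurs⁻ ≤-refl (Stack-≤ (Reads-Stack st r₁)) r₂ o))

-- The letter `z` serves as threshold for `letters-above`: the accessible letters are at most `z`,
-- and `b` lies above it.
record Location (m : ℕ) (t : List ℕ) (os : Code) (a b : List ℕ) : Set where
  constructor location
  field
    {prefix suffix} : Code
    {u v}     : List ℕ
    {m₁ m₂ z} : ℕ
    {t₁ t₂}   : List ℕ
    isSplit   : os ≡ prefix ++ suffix
    readsˡ    : Reads m t prefix u m₁ t₁
    readsʳ    : Reads m₁ t₁ suffix v m₂ t₂
    a⊆u       : a ⊆ u
    b⊆v       : b ⊆ v
    z≤m₁      : z ≤ m₁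
    t₁≤z      : All (_≤ z) t₁
    z<b       : All (z <_) b

-- The split directly after the last letter z of a: then z is the largest accessible letter.
locate : ∀ {m t os w m′ t′} y a b → Stack m t → Reads m t os w m′ t′ →
         y ∷ a ++ b ⊆ w → All (λ x → All (x <_) b) (y ∷ a) → Location m t os (y ∷ a) b
locate y a b s (new r) (_ ∷ʳ q) a<b with locate y a b (Stack-new s) r q a<b
... | location refl r₁ r₂ a⊆u b⊆v z≤m₁ t₁≤z z<b =
  location refl (new r₁) r₂ (_ ∷ʳ a⊆u) b⊆v z≤m₁ t₁≤z z<b
locate y a b s (ret p r) (_ ∷ʳ q) a<b with locate y a b (Stack-Pop s p) r q a<b
... | location refl r₁ r₂ a⊆u b⊆v z≤m₁ t₁≤z z<b =
  location refl (ret p r₁) r₂ (_ ∷ʳ a⊆u) b⊆v z≤m₁ t₁≤z z<b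
locate y [] b s (new r) (refl ∷ q) (y<b ∷ []) =
  location refl (new []) r (refl ∷ []) q ≤-refl (Stack-≤ (Stack-new s)) y<b
locate y [] b s (ret p r) (refl ∷ q) (y<b ∷ []) with Stack-Pop s p
... | y≤m ∷ s₁ = location refl (ret p []) r (refl ∷ []) q y≤m (Stack-≤ (≤-refl ∷ s₁)) y<b
locate y (x ∷ a) b s (new r) (refl ∷ q) (_ ∷ a<b) with locate x a b (Stack-new s) r q a<b
... | location refl r₁ r₂ a⊆u b⊆v z≤m₁ t₁≤z z<b =
  location refl (new r₁) r₂ (refl ∷ a⊆u) b⊆v z≤m₁ t₁≤z z<b
locate y (x ∷ a) b s (ret p r) (refl ∷ q) (_ ∷ a<b) with locate x a b (Stack-Pop s p) r q a<b
... | location refl r₁ r₂ a⊆u b⊆v z≤m₁ t₁≤z z<b =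
  location refl (ret p r₁) r₂ (refl ∷ a⊆u) b⊆v z≤m₁ t₁≤z z<b

locate₀ : ∀ {os w m t} a b → Reads 0 [] os w m t → a ++ b ⊆ w → All (λ x → All (x <_) b) a →
          Location 0 [] os a b
locate₀ []      b r q _   =
  -- Without a last letter of `a` the cut is at the start, with threshold 0.
  location refl [] r [] q z≤n [] (Sublist.All-resp-⊆ q (Reads-positive r))
locate₀ (y ∷ a) b r q a<b = locate y a b [] r q a<b

product-bounds : ∀ α β → All (_≤ blocks α) (word α) ×
                 All (blocks α <_) (map (_+ blocks α) (word β))
product-bounds α β = letters≤maxLetter (word α) ,
  shifted-above ≤-refl (canonical-positive (canonical β))

-- The copy splits into `a` below `b`. At the cut after `a` the letters of `b` exceed the threshold,
-- so they survive the filter that describes the inner code.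
product-occurs⁻ : ∀ {os} α β → CodeOccurs (word (α [ β ])) os →
                  ∃₂ λ p s → os ≡ p ++ s × CodeOccurs (word α) p × InnerOccurs (word β) s
product-occurs⁻ α β (codeOccurs r (occurs {c} c⊆w iso))
  with product-bounds α β
... | ≤r , r<
  with ≅-++⁻ c iso ≤r r<
... | a , b , refl , isoα , isoβ , a<b
  with locate₀ a b r c⊆w a<b
... | location {v = v} {z = z} refl r₁ r₂ a⊆u b⊆v z≤m₁ t₁≤z z<b =
  _ , _ , refl , codeOccurs r₁ (occurs a⊆u isoα) ,
  innerOccurs⁺ z≤m₁ t₁≤z r₂
    (occurs (subst (_⊆ filter (z <?_) v) (filter-all (z <?_) z<b) (Sublist.filter⁺ (z <?_) (z <?_) (λ { refl z<x → z<x }) b⊆v))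
      (≅-trans isoβ (≅-sym (≅-shift (blocks α) (word β)))))

-- The copy of `α` uses letters up to `m₁` and the inner letters lie above `m₁`, so the two copies
-- join in the right order.
product-occurs⁺ : ∀ {d} α β p {s} → Run 0 (p ++ s) d → CodeOccurs (word α) p → InnerOccurs (word β) s →
                  CodeOccurs (word (α [ β ])) (p ++ s)
product-occurs⁺ α β p run oα oβ with decode run
... | w , decodes r _ with Reads-++⁻ p r
... | u , v , m₁ , t₁ , refl , r₁ , r₂ with oα
... | codeOccurs rα (occurs {a} a⊆u isoα) with Reads-det rα r₁
... | refl , refl , refl with innerOccurs⁻ ≤-refl (Stack-≤ (Reads-Stack [] r₁)) r₂ oβ
... | occurs {b} b⊆f isoβ with product-bounds α β
... | ≤r , r< = codeOccurs r (occurs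
  (Sublist.++⁺ a⊆u (⊆-trans b⊆f (Sublist.filter-⊆ (m₁ <?_) v)))
  (≅-++ isoα (≅-trans isoβ (≅-shift (blocks α) (word β)))
    (Sublist.All-resp-⊆ a⊆u
      (subst (λ k → All (_≤ k) u) (sym (Reads-maxLetter [] r₁)) (letters≤maxLetter u)))
    (Sublist.All-resp-⊆ b⊆f (All.all-filter (m₁ <?_) v)) ≤r r<))

-- Replacing a factor

pop? : ∀ j t → Dec (∃₂ λ x t₁ → Pop j t x t₁)
pop? j       []      = no λ()
pop? zero    (x ∷ t) = yes (x , t , here)
pop? (suc j) (y ∷ t) = map′ (λ (x , t₁ , p) → x , t₁ , there p) (λ { (x , t₁ , there p) → x , t₁ , p })
  (pop? j t)

reads? : ∀ m t os → Dec (∃₂ λ w m′ → ∃ λ t′ → Reads m t os w m′ t′)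
reads? m t []         = yes ([] , m , t , [])
reads? m t (new ∷ os) = map′ (λ (_ , _ , _ , r) → _ , _ , _ , new r) (λ { (_ , _ , _ , new r) → _ , _ , _ , r })
  (reads? (suc m) (suc m ∷ t) os)
reads? m t (ret j ∷ os) with pop? j t
... | no ¬p = no λ { (_ , _ , _ , ret p _) → ¬p (_ , _ , p) }
... | yes (x , t₁ , p) = map′ (λ (_ , _ , _ , r) → _ , _ , _ , ret p r) back (reads? m (x ∷ t₁) os)
  where
  back : (∃₂ λ w m′ → ∃ λ t′ → Reads m t (ret j ∷ os) w m′ t′) →
         ∃₂ λ w m′ → ∃ λ t′ → Reads m (x ∷ t₁) os w m′ t′
  back (_ , _ , _ , ret q r) with Pop-det p q
  ... | refl , refl = _ , _ , _ , r

-- Decoding is deterministic, so only one word has to be searched. Decidability makes the search for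
-- a shortest prefix constructive.
codeOccurs? : ∀ t → Decidable (CodeOccurs t)
codeOccurs? t os with reads? 0 [] os
... | no ¬r = no λ (codeOccurs r _) → ¬r (_ , _ , _ , r)
... | yes (w , _ , _ , r) = map′ (codeOccurs r) back (occurs? t w)
  where
  back : CodeOccurs t os → Occurs t w
  back (codeOccurs r′ o) with Reads-det r r′
  ... | refl , _ = o

innerOccurs? : ∀ t → Decidable (InnerOccurs t)
innerOccurs? t s with skeleton s
... | sk , n , f = map′ (innerOccurs f) back (codeOccurs? t n)
  where
  back : InnerOccurs t s → CodeOccurs t n
  back (innerOccurs f′ o) with skeleton-unique f f′ refl
  ... | _ , refl = o

codeOccurs-++ : ∀ {t p q d} → Run 0 (p ++ q) d → CodeOccurs t p → CodeOccurs t (p ++ q)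
codeOccurs-++ {p = p} run (codeOccurs r o) with decode run
... | _ , decodes r′ _ with Reads-++⁻ p r′
... | u , v , _ , _ , refl , r₁ , _ with Reads-det r r₁
... | refl , _ = codeOccurs r′ (Occurs-⊆ (Sublist.++⁺ʳ v ⊆-refl) o)

-- Shortest prefixes and suffixes

module _ {A : Set} where

  ++-compare : ∀ (a c : List A) {b d} → a ++ b ≡ c ++ d →
               (∃ λ e → a ≡ c ++ e × d ≡ e ++ b) ⊎
               (∃₂ λ x e → c ≡ a ++ x ∷ e × b ≡ x ∷ e ++ d)
  ++-compare a       []      eq = inj₁ (a , refl , sym eq)
  ++-compare []      (x ∷ c) eq = inj₂ (x , c , refl , eq)
  ++-compare (x ∷ a) (y ∷ c) eq with ∷-injective eq
  ... | refl , eq′ with ++-compare a c eq′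
  ...   | inj₁ (e , refl , d≡)     = inj₁ (e , refl , d≡)
  ...   | inj₂ (z , e , refl , b≡) = inj₂ (z , e , refl , b≡)

  ShortestPrefix : (List A → Set) → List A → Set
  ShortestPrefix P p = P p × ∀ q x e → p ≡ q ++ x ∷ e → ¬ P q

  ShortestSuffix : (List A → Set) → List A → Set
  ShortestSuffix P s = P s × ∀ x e q → s ≡ x ∷ e ++ q → ¬ P q

  shortestPrefix : ∀ {P} → Decidable P → ∀ l →
                   (∃₂ λ p s → l ≡ p ++ s × ShortestPrefix P p) ⊎ (∀ p s → l ≡ p ++ s → ¬ P p)
  shortestPrefix {P} P? l with P? []
  ... | yes p[] = inj₁ ([] , l , refl , p[] , λ { [] _ _ () ; (_ ∷ _) _ _ () })
  shortestPrefix {P} P? []      | no ¬p[] = inj₂ λ { [] _ _ → ¬p[] }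
  shortestPrefix {P} P? (x ∷ l) | no ¬p[] with shortestPrefix (P? ∘ (x ∷_)) l
  ... | inj₁ (p , s , refl , Pp , minimal) = inj₁ (x ∷ p , s , refl , Pp ,
    λ { [] _ _ _ → ¬p[] ; (_ ∷ q) y e refl → minimal q y e refl })
  ... | inj₂ none = inj₂ λ { [] _ _ → ¬p[] ; (_ ∷ p) s refl → none p s refl }

  shortestSuffix : ∀ {P} → Decidable P → ∀ l →
                   (∃₂ λ p s → l ≡ p ++ s × ShortestSuffix P s) ⊎ (∀ p s → l ≡ p ++ s → ¬ P s)
  shortestSuffix P? [] with P? []
  ... | yes p[] = inj₁ ([] , [] , refl , p[] , λ _ _ _ ())
  ... | no ¬p[] = inj₂ λ { [] _ refl → ¬p[] }
  shortestSuffix P? (x ∷ l) with shortestSuffix P? l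
  ... | inj₁ (p , s , refl , shortest) = inj₁ (x ∷ p , s , refl , shortest)
  ... | inj₂ none with P? (x ∷ l)
  ...   | yes pxl = inj₁ ([] , x ∷ l , refl , pxl , λ { _ e q refl → none e q refl })
  ...   | no ¬pxl = inj₂ λ { [] _ refl → ¬pxl ; (_ ∷ p) s refl → none p s refl }

  shortestPrefix-unique : ∀ {P} p p′ {s s′} → p ++ s ≡ p′ ++ s′ →
                          ShortestPrefix P p → ShortestPrefix P p′ → p ≡ p′ × s ≡ s′
  shortestPrefix-unique p p′ eq (Pp , min) (Pp′ , min′) with ++-compare p p′ eq
  ... | inj₁ ([] , refl , refl)        = ++-identityʳ p′ , refl
  ... | inj₁ (x ∷ e , p≡ , _)          = contradiction Pp′ (min p′ x e p≡)
  ... | inj₂ (x , e , p′≡ , _)         = contradiction Pp (min′ p x e p′≡)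

  shortestSuffix-unique : ∀ {P} p p′ {s s′} → p ++ s ≡ p′ ++ s′ →
                          ShortestSuffix P s → ShortestSuffix P s′ → p ≡ p′ × s ≡ s′
  shortestSuffix-unique p p′ {s} {s′} eq (Ps , min) (Ps′ , min′) with ++-compare p p′ eq
  ... | inj₁ ([] , refl , refl)        = ++-identityʳ p′ , refl
  ... | inj₁ (x ∷ e , _ , s′≡)         = contradiction Ps (min′ x e s s′≡)
  ... | inj₂ (x , e , _ , s≡)          = contradiction Ps′ (min x e s′ s≡)

-- One half of a bijection, given as a relation on codes. The other half is the same notion for the
-- flipped relation, so injectivity is functionality of the flip.
record Transfers (ρ ρ′ : List ℕ) (R : Code → Code → Set) : Set where
  field
    image      : ∀ {os d} → Run 0 os d → ¬ CodeOccurs ρ os →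
                 ∃ λ os′ → R os os′ × Run 0 os′ d × ¬ CodeOccurs ρ′ os′ × length os′ ≡ length os
    functional : ∀ {os os₁ os₂} → R os os₁ → R os os₂ → os₁ ≡ os₂

open Transfers

Transfers-resp : ∀ {ρ ρ′ R S} → (∀ {a b} → R a b → S a b) → (∀ {a b} → S a b → R a b) →
                 Transfers ρ ρ′ R → Transfers ρ ρ′ S
Transfers-resp to from T .image run av with T .image run av
... | os′ , r , rest = os′ , to r , rest
Transfers-resp to from T .functional s₁ s₂ = T .functional (from s₁) (from s₂)

record Correspondence (ρ ρ′ : List ℕ) : Set₁ where
  field
    Related : Code → Code → Set
    forth   : Transfers ρ ρ′ Related
    back    : Transfers ρ′ ρ (flip Related)

-- The two codes share the shortest prefix and the skeleton and enter symmetrically, so the inverse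
-- is the same construction applied to `flip R`.
data ReplaceInner (σ : List ℕ) (R : Code → Code → Set) (os os′ : Code) : Set where
  keep    : (∀ p s → os ≡ p ++ s → ¬ CodeOccurs σ p) → os ≡ os′ → ReplaceInner σ R os os′
  replace : ∀ {p s s′ sk n n′} → ShortestPrefix (CodeOccurs σ) p → Fill sk s n → Fill sk s′ n′ →
            R n n′ → os ≡ p ++ s → os′ ≡ p ++ s′ → ReplaceInner σ R os os′

ReplaceInner-flip : ∀ {σ R a b} → ReplaceInner σ R a b → ReplaceInner σ (flip R) b a
ReplaceInner-flip (keep none refl)            = keep none refl
ReplaceInner-flip (replace min f f′ r eq eq′) = replace min f′ f r eq′ eq

ReplaceInner-transfers : ∀ σ {ρ ρ′ R} → Transfers (word ρ) (word ρ′) R →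
  Transfers (word (σ [ ρ ])) (word (σ [ ρ′ ])) (ReplaceInner (word σ) R)
ReplaceInner-transfers σ {ρ} {ρ′} T .image {os} run av with shortestPrefix (codeOccurs? (word σ)) os
... | inj₂ none = os , keep none refl , run , avoids , refl
  where
  avoids : ¬ CodeOccurs (word (σ [ ρ′ ])) os
  avoids o with product-occurs⁻ σ ρ′ o
  ... | p , s , eq , oσ , _ = none p s eq oσ
... | inj₁ (p , s , refl , min@(oσ , shortest)) with skeleton s
-- The inner code avoids `ρ`, as an occurrence would join the copy of `σ` in `p`.
... | sk , n , f with T .image (Fill⇒Run f) (λ o → av (product-occurs⁺ σ ρ p run oσ (innerOccurs f o)))
... | n′ , r , run′ , av′ , len with refill sk run′
... | s′ , f′ with Run-++⁻ p run
... | d , runₚ , runₛ = p ++ s′ , replace min f f′ r refl refl , runₚₛ′ , avoids , length≡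
  where
  runₚₛ′ = Run-++ runₚ (refill-run f f′ runₛ)
  avoids : ¬ CodeOccurs (word (σ [ ρ′ ])) (p ++ s′)
  avoids o with product-occurs⁻ σ ρ′ o
  ... | p₁ , s₁ , eq , oσ₁ , oρ with ++-compare p p₁ eq
  -- A cut strictly inside `p` contradicts its minimality.
  ...   | inj₁ (x ∷ e , p≡ , _)         = shortest p₁ x e p≡ oσ₁
  ...   | inj₁ ([] , _ , refl)          = inner-avoids oρ
    where
    inner-avoids : ¬ InnerOccurs (word ρ′) s′
    inner-avoids (innerOccurs f″ o) with skeleton-unique f″ f′ refl
    ... | _ , refl = av′ o
  -- For a cut inside `s′`, the suffix is prolonged back to the end of `p`, where `ρ′` still occurs
  -- among the new letters.
  ...   | inj₂ (x , e , _ , refl) with decode runₚₛ′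
  ...     | _ , decodes reads _ with Reads-++⁻ p reads
  ...       | _ , _ , _ , _ , _ , readsₚ , readsₛ
    with innerOccurs-++ (x ∷ e) (Reads-Stack [] readsₚ) readsₛ oρ
  ...         | innerOccurs f″ o′ with skeleton-unique f″ f′ refl
  ...           | _ , refl = av′ o′
  length≡ : length (p ++ s′) ≡ length (p ++ s)
  length≡ = begin
    length (p ++ s′)                  ≡⟨ length-++ p ⟩
    length p + length s′              ≡⟨ cong (length p +_) (Fill-length f′) ⟩
    length p + (gaps sk + length n′)  ≡⟨ cong (λ l → length p + (gaps sk + l)) len ⟩
    length p + (gaps sk + length n)   ≡⟨ cong (length p +_) (Fill-length f) ⟨
    length p + length s               ≡⟨ length-++ p ⟨
    length (p ++ s)                   ∎
    where open ≡-Reasoning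
ReplaceInner-transfers σ T .functional (keep _ refl) (keep _ refl) = refl
ReplaceInner-transfers σ T .functional (keep none _) (replace (oσ , _) _ _ _ eq _) =
  contradiction oσ (none _ _ eq)
ReplaceInner-transfers σ T .functional (replace (oσ , _) _ _ _ eq _) (keep none _) =
  contradiction oσ (none _ _ eq)
ReplaceInner-transfers σ T .functional
  (replace {p} min₁ f₁ f₁′ r₁ refl refl) (replace {p₂} min₂ f₂ f₂′ r₂ eq refl)
  with shortestPrefix-unique p p₂ eq min₁ min₂
... | refl , refl with skeleton-unique f₁ f₂ refl
... | refl , refl = cong (p ++_) (refill-unique f₁′ f₂′ (T .functional r₁ r₂))

data ReplacePrefix (τ : List ℕ) (R : Code → Code → Set) (os os′ : Code) : Set where
  keep    : (∀ p s → os ≡ p ++ s → ¬ InnerOccurs τ s) → os ≡ os′ → ReplacePrefix τ R os os′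
  replace : ∀ {p p′ s} → ShortestSuffix (InnerOccurs τ) s → R p p′ →
            os ≡ p ++ s → os′ ≡ p′ ++ s → ReplacePrefix τ R os os′

ReplacePrefix-flip : ∀ {τ R a b} → ReplacePrefix τ R a b → ReplacePrefix τ (flip R) b a
ReplacePrefix-flip (keep none refl)       = keep none refl
ReplacePrefix-flip (replace min r eq eq′) = replace min r eq′ eq

ReplacePrefix-transfers : ∀ τ {ρ ρ′ R} → Transfers (word ρ) (word ρ′) R →
  Transfers (word (ρ [ τ ])) (word (ρ′ [ τ ])) (ReplacePrefix (word τ) R)
ReplacePrefix-transfers τ {ρ} {ρ′} T .image {os} run av with shortestSuffix (innerOccurs? (word τ)) os
... | inj₂ none = os , keep none refl , run , avoids , refl
  where
  avoids : ¬ CodeOccurs (word (ρ′ [ τ ])) os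
  avoids o with product-occurs⁻ ρ′ τ o
  ... | p , s , eq , _ , oτ = none p s eq oτ
... | inj₁ (p , s , refl , min@(oτ , shortest)) with Run-++⁻ p run
... | d , runₚ , runₛ with T .image runₚ (λ o → av (product-occurs⁺ ρ τ p run o oτ))
-- `p′` ends at the depth of `p`, so `s` may follow it; the minimality of `s` does not mention the
-- prefix.
... | p′ , r , run′ , av′ , len = p′ ++ s , replace min r refl refl , Run-++ run′ runₛ , avoids ,
  trans (length-++ p′) (trans (cong (_+ length s) len) (sym (length-++ p)))
  where
  avoids : ¬ CodeOccurs (word (ρ′ [ τ ])) (p′ ++ s)
  avoids o with product-occurs⁻ ρ′ τ o
  ... | p₁ , s₁ , eq , oρ , oτ₁ with ++-compare p′ p₁ eq
  -- Either the copy of `ρ′` lies within `p′`, or `τ` occurs in a proper suffix of `s`.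
  ...   | inj₁ (e , refl , _)   = av′ (codeOccurs-++ run′ oρ)
  ...   | inj₂ (x , e , _ , s≡) = shortest x e s₁ s≡ oτ₁
ReplacePrefix-transfers τ T .functional (keep _ refl) (keep _ refl) = refl
ReplacePrefix-transfers τ T .functional (keep none _) (replace (oτ , _) _ eq _) =
  contradiction oτ (none _ _ eq)
ReplacePrefix-transfers τ T .functional (replace (oτ , _) _ eq _) (keep none _) =
  contradiction oτ (none _ _ eq)
ReplacePrefix-transfers τ T .functional
  (replace {p} {s = s} min₁ r₁ refl refl) (replace {p₂} min₂ r₂ eq refl)
  with shortestSuffix-unique p p₂ eq min₁ min₂
... | refl , refl = cong (_++ s) (T .functional r₁ r₂)

prepend : ∀ σ {ρ ρ′} → Correspondence (word ρ) (word ρ′) →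
          Correspondence (word (σ [ ρ ])) (word (σ [ ρ′ ]))
prepend σ {ρ} {ρ′} C = record
  { Related = ReplaceInner (word σ) Related
  ; forth   = ReplaceInner-transfers σ {ρ} {ρ′} forth
  ; back    = Transfers-resp ReplaceInner-flip ReplaceInner-flip (ReplaceInner-transfers σ {ρ′} {ρ} back)
  }
  where open Correspondence C

append : ∀ τ {ρ ρ′} → Correspondence (word ρ) (word ρ′) →
         Correspondence (word (ρ [ τ ])) (word (ρ′ [ τ ]))
append τ {ρ} {ρ′} C = record
  { Related = ReplacePrefix (word τ) Related
  ; forth   = ReplacePrefix-transfers τ {ρ} {ρ′} forth
  ; back    = Transfers-resp ReplacePrefix-flip ReplacePrefix-flip (ReplacePrefix-transfers τ {ρ′} {ρ} back)
  }
  where open Correspondence C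

-- Passage between cc-equivalences and correspondences of codes

asAvoider : ∀ {os w d} ρ → Decodes os w d → ¬ CodeOccurs (word ρ) os → Avoider ρ
asAvoider ρ c av = record
  { underlying  = partition c
  ; nonCrossing = Decodes⇒NonCrossing (partition c) c
  ; avoids      = av ∘ codeOccurs (Decodes.reads c) ∘ Contains⇒Occurs {partition c} {ρ}
  }

avoider-avoids : ∀ {ρ os d} (π : Avoider ρ) → Decodes os (word (underlying π)) d →
                 ¬ CodeOccurs (word ρ) os
avoider-avoids {ρ} π (decodes r _) (codeOccurs r′ o) with Reads-det r r′
... | refl , _ = Avoider.avoids π (Occurs⇒Contains {underlying π} {ρ} o)

encodeAvoider : ∀ {ρ} (π : Avoider ρ) → ∃₂ λ os d → Decodes os (word (underlying π)) d
encodeAvoider π = encodeNonCrossing (underlying π) (Avoider.nonCrossing π)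

correspondence : ∀ {ρ ρ′} → CCEquivalent ρ ρ′ → Correspondence (word ρ) (word ρ′)
correspondence {ρ} {ρ′} E = record
  { Related = Related
  ; forth   = record { image = forth-image ; functional = forth-functional }
  ; back    = record { image = back-image ; functional = back-functional }
  }
  where
  open CCEquivalent E
  open Bijection bijection using (to; injective; strictlySurjective) renaming (cong to to-cong)

  Related : Code → Code → Set
  Related os os′ = ∃₂ λ (π : Avoider ρ) d →
    Decodes os (word (underlying π)) d × Decodes os′ (word (underlying (to π))) d

  sameDepth : ∀ {os os′ d d′} (π : Avoider ρ) → Decodes os (word (underlying π)) d →
              Decodes os′ (word (underlying (to π))) d′ → d ≡ d′
  -- `π` has `d` components, hence so has its image, whose only component count is its depth.
  sameDepth {d = d} π c c′ = Equivalence.to (HasComponents⇔depth (underlying (to π)) d c′)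
    (Equivalence.from (preservesComponents π d) (components d (underlying π) c))

  sameLength : ∀ {os os′ d d′} (π : Avoider ρ) → Decodes os (word (underlying π)) d →
               Decodes os′ (word (underlying (to π))) d′ → length os′ ≡ length os
  sameLength π (decodes r _) (decodes r′ _) =
    trans (sym (Reads-length r′)) (trans (preservesSize π) (Reads-length r))

  forth-image : ∀ {os d} → Run 0 os d → ¬ CodeOccurs (word ρ) os →
                ∃ λ os′ → Related os os′ × Run 0 os′ d × ¬ CodeOccurs (word ρ′) os′ ×
                length os′ ≡ length os
  forth-image run av with decode run
  ... | w , c = go (encodeAvoider (to π))
    where
    π = asAvoider ρ c av
    go : (∃₂ λ os′ d′ → Decodes os′ (word (underlying (to π))) d′) → _
    go (os′ , d′ , c′) with sameDepth π c c′
    ... | refl = os′ , (π , d′ , c , c′) , Decodes⇒Run c′ , avoider-avoids (to π) c′ , sameLength π c c′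

  forth-functional : ∀ {os os₁ os₂} → Related os os₁ → Related os os₂ → os₁ ≡ os₂
  forth-functional (π₁ , _ , c₁ , c₁′) (π₂ , _ , c₂ , c₂′) =
    proj₁ (Decodes-injective c₁′ (subst (λ w → Decodes _ w _)
      (sym (to-cong {π₁} {π₂} (proj₁ (Decodes-det c₁ c₂)))) c₂′))

  back-image : ∀ {os′ d} → Run 0 os′ d → ¬ CodeOccurs (word ρ′) os′ →
               ∃ λ os → Related os os′ × Run 0 os d × ¬ CodeOccurs (word ρ) os ×
               length os ≡ length os′
  back-image {os′} {d} run av with decode run
  ... | w , c = go (strictlySurjective (asAvoider ρ′ c av))
    where
    go : (∃ λ π → word (underlying (to π)) ≡ w) → _
    go (π , refl) with encodeAvoider π
    ... | os , _ , c₁ with sameDepth π c₁ c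
    ...   | refl = os , (π , d , c₁ , c) , Decodes⇒Run c₁ , avoider-avoids π c₁ , sym (sameLength π c₁ c)

  back-functional : ∀ {os′ os₁ os₂} → Related os₁ os′ → Related os₂ os′ → os₁ ≡ os₂
  back-functional (π₁ , _ , c₁ , c₁′) (π₂ , _ , c₂ , c₂′) =
    proj₁ (Decodes-injective c₁ (subst (λ w → Decodes _ w _)
      (sym (injective {π₁} {π₂} (proj₁ (Decodes-det c₁′ c₂′)))) c₂))

record Linked (R : Code → Code → Set) (π π′ : Partition) : Set where
  constructor linked
  field
    {code code′} : Code
    {depth}      : ℕ
    decodesˡ     : Decodes code (word π) depth
    decodesʳ     : Decodes code′ (word π′) depth
    related      : R code code′

Linked-flip : ∀ {R π π′} → Linked R π π′ → Linked (flip R) π′ π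
Linked-flip (linked c c′ r) = linked c′ c r

-- Used for well-definedness and surjectivity of the new map and, with the links flipped, for its
-- injectivity.
Linked-functional : ∀ {ρ ρ′ R π₁ π₂ π₁′ π₂′} → Transfers ρ ρ′ R → word π₁ ≡ word π₂ →
                    Linked R π₁ π₁′ → Linked R π₂ π₂′ → word π₁′ ≡ word π₂′
Linked-functional T eq (linked c₁ c₁′ r₁) (linked c₂ c₂′ r₂)
  with proj₁ (Decodes-injective c₁ (subst (λ w → Decodes _ w _) (sym eq) c₂))
... | refl with T .functional r₁ r₂
... | refl = proj₁ (Decodes-det c₁′ c₂′)

transfer : ∀ {ρ ρ′ R} → Transfers (word ρ) (word ρ′) R → (π : Avoider ρ) →
           ∃ λ (π′ : Avoider ρ′) → Linked R (underlying π) (underlying π′) ×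
           size (underlying π′) ≡ size (underlying π)
transfer {ρ′ = ρ′} T π with encodeAvoider π
... | os , d , c with T .image (Decodes⇒Run c) (avoider-avoids π c)
... | os′ , r , run′ , av′ , len with decode run′
... | w′ , c′ = asAvoider ρ′ c′ av′ , linked c c′ r ,
  trans (Reads-length (Decodes.reads c′)) (trans len (sym (Reads-length (Decodes.reads c))))

ccEquivalent : ∀ {ρ ρ′} → NonCrossing ρ → NonCrossing ρ′ → Correspondence (word ρ) (word ρ′) →
               CCEquivalent ρ ρ′
ccEquivalent {ρ} {ρ′} nc nc′ C = record
  { nonCrossingˡ        = nc
  ; nonCrossingʳ        = nc′
  ; bijection           = record
    { to        = to
    ; cong      = λ {π₁} {π₂} eq → Linked-functional {word ρ} {word ρ′} forth eq (link π₁) (link π₂)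
    ; bijective =
      (λ {π₁} {π₂} eq → Linked-functional {word ρ′} {word ρ} back eq (Linked-flip (link π₁)) (Linked-flip (link π₂))) ,
      (λ π′ → proj₁ (from π′) ,
        -- The chosen preimage is linked to `π′` by the backward transfer, and functionality forces
        -- its forward image to agree with `π′`.
        λ {π} eq → Linked-functional {word ρ} {word ρ′} forth eq (link π) (Linked-flip (proj₁ (proj₂ (from π′)))))
    }
  ; preservesSize       = λ π → proj₂ (proj₂ (transfer {ρ} {ρ′} forth π))
  ; preservesComponents = λ π m → sameComponents m (link π)
  }
  where
  open Correspondence C

  to : Avoider ρ → Avoider ρ′
  to = proj₁ ∘ transfer {ρ} {ρ′} forth

  from : (π′ : Avoider ρ′) → _
  from = transfer {ρ′} {ρ} back

  link : ∀ π → Linked Related (underlying π) (underlying (to π))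
  link π = proj₁ (proj₂ (transfer {ρ} {ρ′} forth π))

  sameComponents : ∀ {π π′} m → Linked Related π π′ → HasComponents π′ m ⇔ HasComponents π m
  sameComponents {π} {π′} m (linked c c′ _) =
    ⇔-trans (HasComponents⇔depth π′ m c′) (⇔-sym (HasComponents⇔depth π m c))

theorem3p2 : (σ τ ρ ρ′ : Partition) →
    NonCrossing σ → NonCrossing τ → NonCrossing ρ → NonCrossing ρ′ →
    CCEquivalent ρ ρ′ →
    CCEquivalent (σ [ ρ ] [ τ ]) (σ [ ρ′ ] [ τ ])
theorem3p2 σ τ ρ ρ′ ncσ ncτ ncρ ncρ′ ρ∼ρ′ = ccEquivalent
  (product-nonCrossing (σ [ ρ ]) τ (product-nonCrossing σ ρ ncσ ncρ) ncτ)
  (product-nonCrossing (σ [ ρ′ ]) τ (product-nonCrossing σ ρ′ ncσ ncρ′) ncτ)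
  -- The order follows the left-nested product: first `σ` in front, then `τ` behind.
  (append τ {σ [ ρ ]} {σ [ ρ′ ]} (prepend σ {ρ} {ρ′} (correspondence ρ∼ρ′)))
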